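{- Let $n\geq 3$ and let $G$ be a simple graph of order $2n$ having a perfect matching, with $F(G)=n-1$. Then $G$ is 1-extendable but not 2-extendable if and only if $G$ has a perfect matching $M=\{u_iv_i: i=1,2,\dots,n\}$ with $f(G,M)=n-1$ such that one of the following holds: (i) $n\geq 4$, the induced subgraph $G[\{v_1,\dots,v_n\}]$ consists of one triangle and $n-3$ isolated vertices, and $G[\{u_1,\dots,u_n\}]$ has at least two independent edges; (ii) $\{v_1,\dots,v_{n-1}\}$ is an independent set of $G$, $G[\{u_1,\dots,u_n,v_n\}]$ has at least two independent edges, and $\{v_iv_n, v_ju_n\}\subseteq E(G)$ for some $i,j$ with $1\leq i,j\leq n-1$.
   Context: For a perfect matching $M$ of a graph $G$, a forcing set of $M$ is a subset of $M$ contained in no other perfect matching of $G$; the forcing number $f(G,M)$ is the smallest cardinality of a forcing set of $M$, and $F(G)$ is the maximum of $f(G,M)$ over all perfect matchings $M$ of $G$. For an integer $l\geq 0$, a connected graph $G$ with at least $2l+2$ vertices is $l$-extendable if $G$ has a perfect matching and every matching of size $l$ is contained in a perfect matching of $G$. Independent edges means pairwise disjoint edges. -}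

module Defs where

open import Data.Nat using (ℕ; zero; suc; _+_; _*_; _≤_)
open import Data.Bool using (Bool; true; false)
open import Data.Fin using (Fin)
open import Data.Fin.Subset using (Subset; _∈_; ∣_∣)
open import Data.Sum using (_⊎_; [_,_])
open import Data.Product using (Σ; _×_; ∃; ∃-syntax; _,_)
open import Relation.Binary.PropositionalEquality using (_≡_; _≢_)
open import Function.Definitions using (Injective)

record SimpleGraph (m : ℕ) : Set where
  field
    adj   : Fin m → Fin m → Bool
    sym   : ∀ x y → adj x y ≡ adj y x
    loopless : ∀ x → adj x x ≡ false

open SimpleGraph public

_∼[_]_ : ∀ {m} → Fin m → SimpleGraph m → Fin m → Set
x ∼[ G ] y = adj G x y ≡ true

record PerfectMatching {m : ℕ} (G : SimpleGraph m) : Set where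
  field
    mate      : Fin m → Fin m
    mate-adj  : ∀ x → x ∼[ G ] mate x
    mate-invol : ∀ x → mate (mate x) ≡ x
    mate-nofix : ∀ x → mate x ≢ x

open PerfectMatching public

HasPerfectMatching : ∀ {m} → SimpleGraph m → Set
HasPerfectMatching G = PerfectMatching G

-- A subset S of the edges of M is represented by the set T of vertices
-- covered by S; T must be closed under mate, and |S| = |T| / 2.
-- S ⊆ M' means: every x ∈ T has the same mate in M' as in M.
EdgeSubsetOf : ∀ {m} {G : SimpleGraph m} → PerfectMatching G → Subset m → Set
EdgeSubsetOf M T = ∀ x → x ∈ T → mate M x ∈ T

IsForcingSet : ∀ {m} (G : SimpleGraph m) (M : PerfectMatching G) → Subset m → Set
IsForcingSet G M T =
  EdgeSubsetOf M T ×
  ((M' : PerfectMatching G) → (∀ x → x ∈ T → mate M' x ≡ mate M x) →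
     ∀ x → mate M' x ≡ mate M x)

ForcingNumber : ∀ {m} (G : SimpleGraph m) → PerfectMatching G → ℕ → Set
ForcingNumber G M k =
  (∃[ T ] (IsForcingSet G M T × ∣ T ∣ ≡ 2 * k)) ×
  (∀ T → IsForcingSet G M T → 2 * k ≤ ∣ T ∣)

MaxForcingNumber : ∀ {m} (G : SimpleGraph m) → ℕ → Set
MaxForcingNumber G k =
  (∃[ M ] ForcingNumber G M k) ×
  (∀ M k' → ForcingNumber G M k' → k' ≤ k)

data Reachable {m} (G : SimpleGraph m) : Fin m → Fin m → Set where
  here : ∀ {x} → Reachable G x x
  step : ∀ {x y z} → x ∼[ G ] y → Reachable G y z → Reachable G x z

Connected : ∀ {m} → SimpleGraph m → Set
Connected G = ∀ x y → Reachable G x y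

IsMatchingOfSize : ∀ {m} (G : SimpleGraph m) (l : ℕ) → (Fin l → Fin m) → (Fin l → Fin m) → Set
IsMatchingOfSize {m} G l a b = (∀ i → a i ∼[ G ] b i) × Injective {A = Fin l ⊎ Fin l} {B = Fin m} _≡_ _≡_ [ a , b ]

Extendable : ∀ {m} → ℕ → SimpleGraph m → Set
Extendable {m} l G =
  Connected G × (2 * l + 2 ≤ m) × HasPerfectMatching G ×
  ((a b : Fin l → Fin m) → IsMatchingOfSize G l a b →
     Σ (PerfectMatching G) λ M → (∀ i → mate M (a i) ≡ b i))

TwoIndependentEdges : ∀ {m} (G : SimpleGraph m) → (Fin m → Set) → Set
TwoIndependentEdges G P =
  ∃[ a ] ∃[ b ] ∃[ c ] ∃[ d ]
    (P a × P b × P c × P d × a ∼[ G ] b × c ∼[ G ] d ×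
     a ≢ b × a ≢ c × a ≢ d × b ≢ c × b ≢ d × c ≢ d)

-- Labelled perfect matching M = {u_i v_i : i = 1..n} for n = suc k:
-- index i : Fin (suc k); v_n is v (fromℕ k); v_1..v_{n-1} are v (inject₁ i), i : Fin k.
open import Data.Fin using (fromℕ; inject₁)

Labelling : ∀ {m} (G : SimpleGraph m) (n : ℕ) → PerfectMatching G →
            (Fin n → Fin m) → (Fin n → Fin m) → Set
Labelling {m} G n M u v =
  (∀ i → mate M (u i) ≡ v i) × Injective {A = Fin n ⊎ Fin n} {B = Fin m} _≡_ _≡_ [ u , v ]

ConditionI : ∀ {m} (G : SimpleGraph m) (k : ℕ) → (Fin (suc k) → Fin m) → (Fin (suc k) → Fin m) → Set
ConditionI G k u v =
  4 ≤ suc k ×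
  (∃[ a ] ∃[ b ] ∃[ c ]
     (a ≢ b × a ≢ c × b ≢ c ×
      v a ∼[ G ] v b × v a ∼[ G ] v c × v b ∼[ G ] v c ×
      (∀ i j → v i ∼[ G ] v j →
         (i ≡ a ⊎ i ≡ b ⊎ i ≡ c) × (j ≡ a ⊎ j ≡ b ⊎ j ≡ c)))) ×
  TwoIndependentEdges G (λ x → ∃[ i ] (u i ≡ x))

ConditionII : ∀ {m} (G : SimpleGraph m) (k : ℕ) → (Fin (suc k) → Fin m) → (Fin (suc k) → Fin m) → Set
ConditionII G k u v =
  (∀ i j → adj G (v (inject₁ i)) (v (inject₁ j)) ≡ false) ×
  TwoIndependentEdges G (λ x → (∃[ i ] (u i ≡ x)) ⊎ (v (fromℕ k) ≡ x)) ×
  (∃[ i ] ∃[ j ] (v (inject₁ i) ∼[ G ] v (fromℕ k) × v (inject₁ j) ∼[ G ] u (fromℕ k)))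

{-# OPTIONS --safe #-}
module Submission where

open import Defs
open import Data.Bool using (true; false)
open import Data.Bool.Properties using () renaming (_≟_ to _≟ᵇ_)
open import Data.Empty using (⊥; ⊥-elim)
open import Data.Fin using (Fin; zero; suc; fromℕ; inject₁; opposite; #_)
open import Data.Fin.Patterns using (0F; 1F; 2F; 3F; 4F; 5F; 6F; 7F; 8F; 9F)
open import Data.Fin.Properties using (_≟_; any?; injective⇒≤; opposite-involutive; inject₁-injective; fromℕ≢inject₁)
open import Data.Fin.Relation.Unary.Top using (view; ‵fromℕ; ‵inject₁)
open import Data.Fin.Subset using (Subset; ⊤; ⁅_⁆; _-_; ∣_∣) renaming (_∈_ to _∈ˢ_)
open import Data.Fin.Subset.Properties using (∈⊤; ∣⊤∣≡n; p─q─q≡p─q; p─q⊆p; x∈p∧x≢y⇒x∈p-y; x∈p⇒∣p-x∣<∣p∣)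
open import Data.List using (List; []; _∷_; _++_; map; length; lookup; allFin; tabulate)
open import Data.List.Properties using (length-++; length-map; length-tabulate; map-tabulate; tabulate-lookup; ++-assoc; ++-identityʳ)
open import Data.List.Membership.Propositional using (_∈_; _∉_; find; lose)
open import Data.List.Membership.Propositional.Properties
  using (∈-++⁺ʳ; ∈-++⁻; ∈-∃++; ∈-lookup; ∈-allFin; ∈-map⁻; ∈-tabulate⁻)
open import Data.List.Relation.Binary.Permutation.Propositional
  using (_↭_; refl; prep; swap; trans; ↭-sym; ↭-reflexive; ↭⇒↭ₛ)
open import Data.List.Relation.Binary.Permutation.Propositional.Properties
  using (shift; ↭-length; map⁺; ∈-resp-↭; All-resp-↭; drop-∷; ++⁺ˡ; ++⁺ʳ; shifts)
import Data.List.Relation.Binary.Permutation.Setoid.Properties as Permₛ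
open import Data.List.Relation.Unary.All as All using (All; []; _∷_)
open import Data.List.Relation.Unary.AllPairs using (AllPairs; []; _∷_; allPairs?)
open import Data.List.Relation.Unary.Any as Any using (here; there)
open import Data.List.Relation.Unary.Any.Properties using (lookup-index)
open import Data.List.Relation.Unary.Unique.Propositional using (Unique)
open import Data.List.Relation.Unary.Unique.Propositional.Properties
  using (allFin⁺; tabulate⁺) renaming (++⁺ to Unique-++⁺; map⁺ to Unique-map⁺)
open import Data.Nat using (ℕ; zero; suc; _+_; _*_; _≤_; _<_; s≤s)
open import Data.Nat.Properties
  using (≤-refl; ≤-trans; ≤-reflexive; <-irrefl; suc-injective; +-suc; +-comm; +-identityʳ; +-monoˡ-≤; +-monoʳ-≤;
    +-cancelʳ-≤; *-suc; *-monoʳ-≤; n≤1+n; m≤m+n; <⇒≱)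
open import Data.Product using (Σ; ∃; ∃₂; _×_; _,_; proj₁; proj₂)
open import Data.Sum using (_⊎_; inj₁; inj₂; [_,_]; map₁)
open import Function using (_∘_; id; case_of_)
open import Function.Bundles using (_⇔_; mk⇔)
open import Function.Definitions using (Injective)
open import Relation.Binary.PropositionalEquality
  using (_≡_; _≢_; refl; cong; cong₂; subst; subst₂; ≢-sym; setoid; module ≡-Reasoning)
  renaming (sym to ≡-sym; trans to ≡-trans)
open import Relation.Nullary using (¬_; Dec; yes; no; contradiction)
open import Relation.Nullary.Decidable using (_×-dec_; _⊎-dec_; ¬?; True; toWitness)
open import Relation.Unary using (Decidable)

-- f(G,M) = n − 1 forces any two edges xx', yy' of M to span an alternating 4-cycle: xy, x'y' ∈ E or
-- xy', x'y ∈ E. So x ≁ y always gives x ~ y', which lets augmenting paths be read off from non-edges.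
--
-- Delete the ends of one edge, or of two edges, and keep the untouched edges of M: two (respectively four)
-- vertices p, q (r, s) remain unmatched. With two, either an M-augmenting path with at most two edges of M joins
-- them, or one end of every untouched edge can be chosen so that these ends together with p and q are independent.
-- With four, either the rest has a perfect matching or the ends can be chosen so that p, q, r, s and
-- the ends span no two independent edges, i.e. their edges form a star or a triangle. The other ends contain
-- the two deleted edges. A triangle is condition (i); a star centred at v_n is condition (ii), where
-- 1-extendability forces v_n and u_n to have neighbours among the leaves, since otherwise one end
-- of every edge of M would form an independent set missing a whole edge of G. Two deleted edges that meet
-- a common edge of M, or one of which lies in M, leave only two unmatched vertices and again give (ii).
--
-- Conversely, under (i) or (ii) no independent set contains one end of every edge of M, so G is 1-extendable,
-- and a perfect matching through the two given independent edges would need too many vertices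
-- to match the isolated v_i (respectively v_1, …, v_{n−1}).

-- Duplicate-free lists up to permutation.

module _ {A : Set} where

  Unique-resp-↭ : {xs ys : List A} → xs ↭ ys → Unique xs → Unique ys
  Unique-resp-↭ σ = Permₛ.Unique-resp-↭ (setoid A) (↭⇒↭ₛ σ)

  lookup-injective : {xs : List A} → Unique xs → ∀ i j → lookup xs i ≡ lookup xs j → i ≡ j
  lookup-injective (_ ∷ _) zero zero _ = refl
  lookup-injective (x∉ ∷ _) zero (suc j) eq = contradiction eq (All.lookup x∉ (∈-lookup j))
  lookup-injective (x∉ ∷ _) (suc i) zero eq = contradiction (≡-sym eq) (All.lookup x∉ (∈-lookup i))
  lookup-injective (_ ∷ !xs) (suc i) (suc j) eq = cong suc (lookup-injective !xs i j eq)

  ∈⇒↭∷ : {x : A} {xs : List A} → x ∈ xs → ∃ λ ys → xs ↭ x ∷ ys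
  ∈⇒↭∷ x∈xs with ∈-∃++ x∈xs
  ... | ys , zs , refl = ys ++ zs , shift _ ys zs

  ∈-tail : {x y : A} {ys : List A} → x ∈ y ∷ ys → x ≢ y → x ∈ ys
  ∈-tail (here eq) x≢y = contradiction eq x≢y
  ∈-tail (there x∈ys) _ = x∈ys

  -- Abstract because with-abstraction would otherwise normalise these on explicit lists, which is very slow.
  abstract

    Unique-++⁻ : ∀ xs {ys : List A} → Unique (xs ++ ys) → Unique ys × (∀ {x} → x ∈ xs → x ∉ ys)
    Unique-++⁻ [] !ys = !ys , λ ()
    Unique-++⁻ (x ∷ xs) (x∉ ∷ !xs) with Unique-++⁻ xs !xs
    ... | !ys , disjoint = !ys , λ { (here refl) y∈ → All.lookup x∉ (∈-++⁺ʳ xs y∈) refl ; (there x∈) → disjoint x∈ }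

    -- Turns an inclusion into a splitting with a named remainder `zs`; this is how a few vertices
    -- or edges of a configuration are isolated from all the others.
    extract : {xs ys : List A} → Unique xs → (∀ {x} → x ∈ xs → x ∈ ys) → ∃ λ zs → ys ↭ xs ++ zs
    extract {[]} {ys} _ _ = ys , refl
    extract {x ∷ xs} (x∉ ∷ !xs) xs⊆ with ∈⇒↭∷ (xs⊆ (here refl))
    ... | ys′ , σ with extract !xs (λ y∈ → ∈-tail (∈-resp-↭ σ (xs⊆ (there y∈))) (≢-sym (All.lookup x∉ y∈)))
    ...   | zs , τ = zs , trans σ (prep x τ)

  search : {P : A → Set} → Decidable P → ∀ xs → (∃ λ x → x ∈ xs × P x) ⊎ (∀ {x} → x ∈ xs → ¬ P x)
  search P? xs with Any.any? P? xs
  ... | yes p = inj₁ (find p)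
  ... | no ¬p = inj₂ λ x∈ px → ¬p (lose x∈ px)

Unique⇒length≤ : ∀ {m} {xs : List (Fin m)} → Unique xs → length xs ≤ m
Unique⇒length≤ !xs = injective⇒≤ (lookup-injective !xs _ _)

Unique-⊆⇒length≤ : {A : Set} {xs ys : List A} → Unique xs → (∀ {x} → x ∈ xs → x ∈ ys) → length xs ≤ length ys
Unique-⊆⇒length≤ {xs = xs} !xs xs⊆ with extract !xs xs⊆
... | zs , σ = ≤-trans (m≤m+n (length xs) (length zs)) (≤-reflexive (≡-sym (≡-trans (↭-length σ) (length-++ xs))))

Unique⇒↭allFin : ∀ {m} {xs : List (Fin m)} → Unique xs → length xs ≡ m → xs ↭ allFin m
Unique⇒↭allFin {m} {xs} !xs len with extract !xs (λ {x} _ → ∈-allFin x)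
... | [] , σ = ↭-sym (trans σ (↭-reflexive (++-identityʳ xs)))
... | z ∷ zs , σ = contradiction (≤-reflexive eq) (<⇒≱ (s≤s (m≤m+n _ _)))
  where
  eq : suc (m + length zs) ≡ m
  eq = begin
    suc (m + length zs)              ≡⟨ ≡-sym (+-suc m _) ⟩
    m + length (z ∷ zs)              ≡⟨ cong (_+ length (z ∷ zs)) (≡-sym len) ⟩
    length xs + length (z ∷ zs)      ≡⟨ ≡-sym (length-++ xs) ⟩
    length (xs ++ z ∷ zs)            ≡⟨ ≡-sym (↭-length σ) ⟩
    length (allFin m)                ≡⟨ length-tabulate id ⟩
    m                                ∎
    where open ≡-Reasoning

opposite-fromℕ : ∀ n → opposite (fromℕ n) ≡ zero
opposite-fromℕ zero = refl
opposite-fromℕ (suc n) = cong inject₁ (opposite-fromℕ n)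

opposite-inject₁ : ∀ {n} (i : Fin n) → opposite (inject₁ i) ≡ suc (opposite i)
opposite-inject₁ zero = refl
opposite-inject₁ (suc i) = cong inject₁ (opposite-inject₁ i)

-- Edge lists and the vertex lists they cover.

pairs : {A : Set} → List (A × A) → List A
pairs [] = []
pairs ((x , y) ∷ P) = x ∷ y ∷ pairs P

module _ {A : Set} where

  pairs-++ : (P Q : List (A × A)) → pairs (P ++ Q) ≡ pairs P ++ pairs Q
  pairs-++ [] Q = refl
  pairs-++ ((x , y) ∷ P) Q = cong (λ l → x ∷ y ∷ l) (pairs-++ P Q)

  ∈-pairsˡ : ∀ {x y : A} {P} → (x , y) ∈ P → x ∈ pairs P
  ∈-pairsˡ (here refl) = here refl
  ∈-pairsˡ (there e∈) = there (there (∈-pairsˡ e∈))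

  ∈-pairsʳ : ∀ {x y : A} {P} → (x , y) ∈ P → y ∈ pairs P
  ∈-pairsʳ (here refl) = there (here refl)
  ∈-pairsʳ (there e∈) = there (there (∈-pairsʳ e∈))

  ∈-pairs⁻ : ∀ {x : A} P → x ∈ pairs P → ∃ λ y → (x , y) ∈ P ⊎ (y , x) ∈ P
  ∈-pairs⁻ ((a , b) ∷ P) (here refl) = b , inj₁ (here refl)
  ∈-pairs⁻ ((a , b) ∷ P) (there (here refl)) = a , inj₂ (here refl)
  ∈-pairs⁻ (_ ∷ P) (there (there x∈)) with ∈-pairs⁻ P x∈
  ... | y , inj₁ e∈ = y , inj₁ (there e∈)
  ... | y , inj₂ e∈ = y , inj₂ (there e∈)

  pairs-↭ : ∀ {P Q : List (A × A)} → P ↭ Q → pairs P ↭ pairs Q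
  pairs-↭ refl = refl
  pairs-↭ (prep _ σ) = prep _ (prep _ (pairs-↭ σ))
  pairs-↭ {(a , b) ∷ (c , d) ∷ P} (swap _ _ σ) =
    trans (shifts (a ∷ b ∷ []) (c ∷ d ∷ [])) (prep _ (prep _ (prep _ (prep _ (pairs-↭ σ)))))
  pairs-↭ (trans σ τ) = trans (pairs-↭ σ) (pairs-↭ τ)

-- Perfect matchings of induced subgraphs, as lists of edges.

module Matchings {m : ℕ} (G : SimpleGraph m) where

  V : Set
  V = Fin m

  open import Data.List.Membership.DecPropositional (_≟_ {m}) public using (_∈?_)

  infix 4 _~_ _~?_

  _~_ : V → V → Set
  x ~ y = x ∼[ G ] y

  _~?_ : ∀ x y → Dec (x ~ y)
  x ~? y = adj G x y ≟ᵇ true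

  ~-sym : ∀ {x y} → x ~ y → y ~ x
  ~-sym {x} {y} x~y = ≡-trans (SimpleGraph.sym G y x) x~y

  ~-irrefl : ∀ {x} → ¬ (x ~ x)
  ~-irrefl {x} x~x with ≡-trans (≡-sym (loopless G x)) x~x
  ... | ()

  ~⇒≢ : ∀ {x y} → x ~ y → x ≢ y
  ~⇒≢ x~y refl = ~-irrefl x~y

  Edge : V × V → Set
  Edge (x , y) = x ~ y

  -- For a duplicate-free `L`, a perfect matching of the subgraph induced on `L`. Working up to
  -- permutation makes the order in which vertices are removed irrelevant.
  Matchable : List V → Set
  Matchable L = ∃ λ P → All Edge P × pairs P ↭ L

  Matchable-resp-↭ : ∀ {L L′} → L ↭ L′ → Matchable L → Matchable L′
  Matchable-resp-↭ σ (P , edges , τ) = P , edges , trans τ σ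

  Matchable-∷ : ∀ {x y L} → x ~ y → Matchable L → Matchable (x ∷ y ∷ L)
  Matchable-∷ x~y (P , edges , τ) = _ ∷ P , x~y ∷ edges , prep _ (prep _ τ)

  Matchable-∷⁻ : ∀ {x L} → Matchable (x ∷ L) → ∃ λ y → x ~ y × ∃ λ L′ → (L ↭ y ∷ L′) × Matchable L′
  Matchable-∷⁻ {x} (P , edges , τ) with ∈-pairs⁻ P (∈-resp-↭ (↭-sym τ) (here refl))
  ... | y , inj₁ e∈ with ∈⇒↭∷ e∈
  ...   | P′ , σ with All-resp-↭ σ edges
  ...     | x~y ∷ edges′ =
    y , x~y , pairs P′ , drop-∷ (trans (↭-sym τ) (pairs-↭ σ)) , P′ , edges′ , refl
  Matchable-∷⁻ {x} (P , edges , τ) | y , inj₂ e∈ with ∈⇒↭∷ e∈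
  ...   | P′ , σ with All-resp-↭ σ edges
  ...     | y~x ∷ edges′ =
    y , ~-sym y~x , pairs P′
      , drop-∷ (trans (↭-sym τ) (trans (pairs-↭ σ) (swap _ _ refl)))
      , P′ , edges′ , refl

  -- Turns the classical case distinctions below into constructive ones: the extendability hypotheses are only
  -- negative, while the labelling has to be computed.
  matchable? : ∀ L → Dec (Matchable L)
  matchable? L = bounded (length L) L ≤-refl
    where
    -- The recursion runs on a bound for the length, because the list left after removing a partner
    -- is known only up to permutation.
    bounded : ∀ n L → length L ≤ n → Dec (Matchable L)
    bounded _ [] _ = yes ([] , [] , refl)
    bounded (suc n) (x ∷ L) (s≤s len) with any? partner?
      where
      Partner : V → Set
      Partner y = x ~ y × ∃ λ L′ → (L ↭ y ∷ L′) × Matchable L′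

      partner? : ∀ y → Dec (Partner y)
      partner? y with x ~? y | y ∈? L
      ... | no x≁y | _ = no (x≁y ∘ proj₁)
      ... | yes _ | no y∉L = no λ (_ , _ , σ , _) → y∉L (∈-resp-↭ (↭-sym σ) (here refl))
      ... | yes x~y | yes y∈L with ∈⇒↭∷ y∈L
      ...   | L₀ , σ₀ with bounded n L₀ (≤-trans (n≤1+n _) (≤-trans (≤-reflexive (≡-sym (↭-length σ₀))) len))
      ...     | yes mt = yes (x~y , L₀ , σ₀ , mt)
      -- Any other remainder after removing `y` is a permutation of `L₀`, so refuting one refutes
      -- all.
      ...     | no ¬mt = no λ (_ , _ , σ , mt) → ¬mt (Matchable-resp-↭ (drop-∷ (trans (↭-sym σ) σ₀)) mt)
    ... | yes (y , x~y , L′ , σ , mt) = yes (Matchable-resp-↭ (prep x (↭-sym σ)) (Matchable-∷ x~y mt))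
    ... | no none = no (none ∘ Matchable-∷⁻)

  partner : List (V × V) → V → V
  -- Default value for a vertex on no edge of the list. A perfect matching is built only from a list
  -- that covers every vertex.
  partner [] x = x
  partner ((a , b) ∷ P) x with x ≟ a | x ≟ b
  ... | yes _ | _ = b
  ... | no _ | yes _ = a
  ... | no _ | no _ = partner P x

  -- By uniqueness, the first pair met that contains `x` or `y` is the pair `(x , y)` itself.
  partner-∈ : ∀ {x y} P → Unique (pairs P) → (x , y) ∈ P → partner P x ≡ y × partner P y ≡ x
  partner-∈ {x} {y} ((a , b) ∷ P) ((a≢b ∷ a∉) ∷ b∉ ∷ !P) e∈
    with x ≟ a | x ≟ b | y ≟ a | y ≟ b | e∈
  ... | yes _ | _ | no _ | yes _ | here refl = refl , refl
  ... | yes _ | _ | no _ | no y≢b | here refl = contradiction refl y≢b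
  ... | yes _ | _ | yes refl | _ | here refl = contradiction refl a≢b
  ... | no x≢a | _ | _ | _ | here refl = contradiction refl x≢a
  ... | yes refl | _ | _ | _ | there e∈′ = contradiction refl (All.lookup a∉ (∈-pairsˡ e∈′))
  ... | no _ | yes refl | _ | _ | there e∈′ = contradiction refl (All.lookup b∉ (∈-pairsˡ e∈′))
  ... | no _ | no _ | yes refl | _ | there e∈′ = contradiction refl (All.lookup a∉ (∈-pairsʳ e∈′))
  ... | no _ | no _ | no _ | yes refl | there e∈′ = contradiction refl (All.lookup b∉ (∈-pairsʳ e∈′))
  ... | no _ | no _ | no _ | no _ | there e∈′ = partner-∈ P !P e∈′

  toPerfectMatching : ∀ P → All Edge P → pairs P ↭ allFin m →
    Σ (PerfectMatching G) λ N → ∀ {x y} → (x , y) ∈ P → mate N x ≡ y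
  toPerfectMatching P edges σ =
    record
      { mate = partner P
      ; mate-adj = λ x → proj₁ (matched x)
      ; mate-invol = λ x → proj₂ (matched x)
      ; mate-nofix = λ x → ~⇒≢ (~-sym (proj₁ (matched x)))
      } , λ e∈ → proj₁ (partner-∈ P !P e∈)
    where
    !P : Unique (pairs P)
    !P = Unique-resp-↭ (↭-sym σ) (allFin⁺ m)

    matched : ∀ x → x ~ partner P x × partner P (partner P x) ≡ x
    matched x with ∈-pairs⁻ P (∈-resp-↭ (↭-sym σ) (∈-allFin x))
    ... | y , inj₁ e∈ with partner-∈ P !P e∈
    ...   | x↦y , y↦x rewrite x↦y = All.lookup edges e∈ , y↦x
    matched x | y , inj₂ e∈ with partner-∈ P !P e∈
    ...   | y↦x , x↦y rewrite x↦y = ~-sym (All.lookup edges e∈) , y↦x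

-- The i-th entry of the index list says where the i-th element of the left-hand side sits in ys.
rearrange : {A : Set} {ys : List A} (is : List (Fin (length ys))) → length is ≡ length ys →
  {True (allPairs? (λ i j → ¬? (i ≟ j)) is)} → map (lookup ys) is ↭ ys
rearrange {ys = ys} is len {distinct} =
  trans (map⁺ (lookup ys) (Unique⇒↭allFin (toWitness distinct) len))
    (↭-reflexive (≡-trans (map-tabulate id (lookup ys)) (tabulate-lookup ys)))

-- Chosen ends of edges of M, independence, and disjoint edges.

module GoodMatching {m : ℕ} (G : SimpleGraph m) (M : PerfectMatching G) where

  open Matchings G public

  μ : V → V
  μ = mate M

  μμ : ∀ x → μ (μ x) ≡ x
  μμ = mate-invol M

  -- A list S of vertices stands for the edges of M at them, with a chosen end of each; a choice of other ends is
  -- a list S′ with flat S′ ↭ flat S.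
  flat : List V → List V
  flat S = pairs (map (λ v → v , μ v) S)

  flat-++ : ∀ S T → flat (S ++ T) ≡ flat S ++ flat T
  flat-++ [] T = refl
  flat-++ (v ∷ S) T = cong (λ l → v ∷ μ v ∷ l) (flat-++ S T)

  flat-↭ : ∀ {S T} → S ↭ T → flat S ↭ flat T
  flat-↭ σ = pairs-↭ (map⁺ _ σ)

  flat-flip : ∀ v S → flat (μ v ∷ S) ↭ flat (v ∷ S)
  flat-flip v S = trans (swap _ _ refl) (↭-reflexive (cong (λ x → x ∷ μ v ∷ flat S) (μμ v)))

  ∈-flat⁺ : ∀ {v S} → v ∈ S → v ∈ flat S
  ∈-flat⁺ (here refl) = here refl
  ∈-flat⁺ (there v∈) = there (there (∈-flat⁺ v∈))

  ∈-flat⁺′ : ∀ {v S} → v ∈ S → μ v ∈ flat S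
  ∈-flat⁺′ (here refl) = there (here refl)
  ∈-flat⁺′ (there v∈) = there (there (∈-flat⁺′ v∈))

  ∈-flat⁻ : ∀ {x} S → x ∈ flat S → x ∈ S ⊎ μ x ∈ S
  ∈-flat⁻ (v ∷ S) (here refl) = inj₁ (here refl)
  ∈-flat⁻ (v ∷ S) (there (here refl)) = inj₂ (here (μμ v))
  ∈-flat⁻ (v ∷ S) (there (there x∈)) with ∈-flat⁻ S x∈
  ... | inj₁ x∈S = inj₁ (there x∈S)
  ... | inj₂ μx∈S = inj₂ (there μx∈S)

  flat-closed : ∀ {x} S → x ∈ flat S → μ x ∈ flat S
  flat-closed S x∈ with ∈-flat⁻ S x∈
  ... | inj₁ x∈S = ∈-flat⁺′ x∈S
  ... | inj₂ μx∈S = ∈-flat⁺ μx∈S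

  flat-split : ∀ {x S} → x ∈ flat S → ∃ λ S₀ → flat (x ∷ S₀) ↭ flat S
  flat-split {x} {S} x∈ with ∈-flat⁻ S x∈
  ... | inj₁ x∈S with ∈⇒↭∷ x∈S
  ...   | S₀ , σ = S₀ , flat-↭ (↭-sym σ)
  flat-split {x} {S} x∈ | inj₂ μx∈S with ∈⇒↭∷ μx∈S
  ...   | S₀ , σ = S₀ , trans (↭-sym (flat-flip x S₀)) (flat-↭ (↭-sym σ))

  flat-unique : ∀ S → Unique (flat S) → Unique S
  flat-unique [] _ = []
  flat-unique (v ∷ S) ((_ ∷ v∉) ∷ _ ∷ !S) = All.tabulate (λ y∈ → All.lookup v∉ (∈-flat⁺ y∈)) ∷ flat-unique S !S

  mate∉ : ∀ {x} S → Unique (flat S) → x ∈ S → μ x ∉ S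
  mate∉ (v ∷ S) ((v≢ ∷ _) ∷ _) (here refl) (here eq) = v≢ (≡-sym eq)
  mate∉ (v ∷ S) (_ ∷ v′∉ ∷ _) (here refl) (there μx∈) = All.lookup v′∉ (∈-flat⁺ μx∈) refl
  mate∉ {x} (v ∷ S) (_ ∷ v′∉ ∷ _) (there x∈) (here eq) =
    All.lookup v′∉ (∈-flat⁺ x∈) (≡-trans (cong μ (≡-sym eq)) (μμ x))
  mate∉ (v ∷ S) (_ ∷ _ ∷ !S) (there x∈) (there μx∈) = mate∉ S !S x∈ μx∈

  mate-edges : ∀ S → All Edge (map (λ v → v , μ v) S)
  mate-edges [] = []
  mate-edges (v ∷ S) = mate-adj M v ∷ mate-edges S

  match : ∀ P → All Edge P → ∀ S {L} → pairs P ++ flat S ↭ L → Matchable L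
  match P edges S σ =
    P ++ map _ S , All++ edges (mate-edges S) , trans (↭-reflexive (pairs-++ P _)) σ
    where
    open import Data.List.Relation.Unary.All.Properties renaming (++⁺ to All++)

  -- Replacing an end by its mate leaves the edge of `M` unchanged, so a property that one end of
  -- each edge can satisfy is arranged edge by edge.
  orient : ∀ {P : V → Set} S → (∀ {v} → v ∈ S → ∃ λ w → (w ≡ v ⊎ w ≡ μ v) × P w) →
    ∃ λ S′ → flat S′ ↭ flat S × (∀ {w} → w ∈ S′ → P w)
  orient [] _ = [] , refl , λ ()
  orient (v ∷ S) choose with choose (here refl) | orient S (choose ∘ there)
  ... | w , w≡ , Pw | S′ , σ , PS′ = w ∷ S′ , flip w≡ , λ { (here refl) → Pw ; (there w∈) → PS′ w∈ }
    where
    flip : w ≡ v ⊎ w ≡ μ v → flat (w ∷ S′) ↭ flat (v ∷ S)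
    flip (inj₁ refl) = prep _ (prep _ σ)
    flip (inj₂ refl) = trans (flat-flip v S′) (prep _ (prep _ σ))

  Indep : List V → Set
  Indep L = ∀ {x y} → x ∈ L → y ∈ L → ¬ (x ~ y)

  Indep-∷ : ∀ {x L} → (∀ {y} → y ∈ L → ¬ (x ~ y)) → Indep L → Indep (x ∷ L)
  Indep-∷ x≁ ind (here refl) (here refl) = ~-irrefl
  Indep-∷ x≁ ind (here refl) (there y∈) = x≁ y∈
  Indep-∷ x≁ ind (there x∈) (here refl) = x≁ x∈ ∘ ~-sym
  Indep-∷ x≁ ind (there x∈) (there y∈) = ind x∈ y∈

  Indep-⊆ : ∀ {L L′} → (∀ {x} → x ∈ L′ → x ∈ L) → Indep L → Indep L′
  Indep-⊆ sub ind x∈ y∈ = ind (sub x∈) (sub y∈)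

  NoTwo : List V → Set
  NoTwo L = ∀ {x y z w} → x ∈ L → y ∈ L → z ∈ L → w ∈ L → x ~ y → z ~ w →
    x ≢ z → x ≢ w → y ≢ z → y ≢ w → ⊥

  NoTwo-resp-↭ : ∀ {L L′} → L ↭ L′ → NoTwo L → NoTwo L′
  NoTwo-resp-↭ {L} {L′} σ noTwo x∈ y∈ z∈ w∈ = noTwo (back x∈) (back y∈) (back z∈) (back w∈)
    where
    back : ∀ {x} → x ∈ L′ → x ∈ L
    back = ∈-resp-↭ (↭-sym σ)

  -- Every edge contains the centre `c`, so any two edges meet.
  NoTwo-star : ∀ {c I} → Indep I → NoTwo (c ∷ I)
  NoTwo-star ind (here refl) _ (here refl) _ _ _ x≢z _ _ _ = x≢z refl
  NoTwo-star ind (here refl) _ _ (here refl) _ _ _ x≢w _ _ = x≢w refl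
  NoTwo-star ind (here refl) _ (there z∈) (there w∈) _ z~w _ _ _ _ = ind z∈ w∈ z~w
  NoTwo-star ind _ (here refl) (here refl) _ _ _ _ _ y≢z _ = y≢z refl
  NoTwo-star ind _ (here refl) _ (here refl) _ _ _ _ _ y≢w = y≢w refl
  NoTwo-star ind (there _) (here refl) (there z∈) (there w∈) _ z~w _ _ _ _ = ind z∈ w∈ z~w
  NoTwo-star ind (there x∈) (there y∈) _ _ x~y _ _ _ _ _ = ind x∈ y∈ x~y

  -- Every edge contains `c` or `d`. Of two disjoint edges, one is at `c` and the other at `d`, and
  -- their further ends are distinct members of `I`, which the last hypothesis forbids.
  NoTwo-doubleStar : ∀ {c d I} → Indep I →
    (∀ {x y} → x ∈ I → y ∈ I → x ≢ y → c ~ x → d ~ y → ⊥) → NoTwo (c ∷ d ∷ I)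
  NoTwo-doubleStar {c} {d} {I} ind cross {x} {y} {z} {w} x∈ y∈ z∈ w∈ x~y z~w x≢z x≢w y≢z y≢w =
    combine (center x∈ y∈ x~y) (center z∈ w∈ z~w)
    where
    Center : V → Set
    Center x = x ≡ c ⊎ x ≡ d

    center : ∀ {x y} → x ∈ c ∷ d ∷ I → y ∈ c ∷ d ∷ I → x ~ y → Center x ⊎ Center y
    center (here refl) _ _ = inj₁ (inj₁ refl)
    center (there (here refl)) _ _ = inj₁ (inj₂ refl)
    center _ (here refl) _ = inj₂ (inj₁ refl)
    center _ (there (here refl)) _ = inj₂ (inj₂ refl)
    center (there (there x∈)) (there (there y∈)) x~y = contradiction x~y (ind x∈ y∈)

    go : ∀ {x y z w} → Center x → Center z → y ∈ c ∷ d ∷ I → w ∈ c ∷ d ∷ I → x ~ y → z ~ w →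
      x ≢ z → x ≢ w → y ≢ z → y ≢ w → ⊥
    go (inj₁ refl) (inj₁ refl) _ _ _ _ x≢z _ _ _ = x≢z refl
    go (inj₂ refl) (inj₂ refl) _ _ _ _ x≢z _ _ _ = x≢z refl
    go (inj₁ refl) (inj₂ refl) y∈ w∈ x~y z~w _ x≢w y≢z y≢w =
      cross (∈-tail (∈-tail y∈ (≢-sym (~⇒≢ x~y))) y≢z)
            (∈-tail (∈-tail w∈ (≢-sym x≢w)) (≢-sym (~⇒≢ z~w))) y≢w x~y z~w
    go (inj₂ refl) (inj₁ refl) y∈ w∈ x~y z~w _ x≢w y≢z y≢w =
      cross (∈-tail (∈-tail w∈ (≢-sym (~⇒≢ z~w))) (≢-sym x≢w))
            (∈-tail (∈-tail y∈ y≢z) (≢-sym (~⇒≢ x~y))) (≢-sym y≢w) z~w x~y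

    combine : Center x ⊎ Center y → Center z ⊎ Center w → ⊥
    combine (inj₁ xc) (inj₁ zc) = go xc zc y∈ w∈ x~y z~w x≢z x≢w y≢z y≢w
    combine (inj₁ xc) (inj₂ wc) = go xc wc y∈ z∈ x~y (~-sym z~w) x≢w x≢z y≢w y≢z
    combine (inj₂ yc) (inj₁ zc) = go yc zc x∈ w∈ (~-sym x~y) z~w y≢z y≢w x≢z x≢w
    combine (inj₂ yc) (inj₂ wc) = go yc wc x∈ z∈ (~-sym x~y) (~-sym z~w) y≢w y≢z x≢w x≢z

  -- The two inequalities say that `x` and `y` lie on different edges of `M`; the disjunction lists
  -- the two alternating 4-cycles that these edges may span.
  Good : Set
  Good = ∀ {x y} → x ≢ y → x ≢ μ y → (x ~ y × μ x ~ μ y) ⊎ (x ~ μ y × μ x ~ y)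

  -- The edges P may rematch X with the edges of M at Q only, keeping all other edges of M.
  refute : ∀ X Q {S S′} P → ¬ Matchable (X ++ flat S) → flat S′ ↭ flat S →
    Unique Q → All (_∈ S′) Q → All Edge P → pairs P ↭ X ++ flat Q → ⊥
  refute X Q {S} P ¬mt τ !Q Q⊆ edges σ with extract !Q (All.lookup Q⊆)
  ... | S₀ , ρ = ¬mt (match P edges S₀ (trans (++⁺ʳ (flat S₀) σ) (trans (↭-reflexive (++-assoc X _ _))
          (++⁺ˡ X (trans (↭-reflexive (≡-sym (flat-++ Q S₀))) (trans (flat-↭ (↭-sym ρ)) τ))))))

  -- Two exposed vertices: an augmenting path or an independent choice of ends.

  module Exchange (good : Good) where

    -- Of the two possible alternating 4-cycles, the one through `x y` is ruled out. If `x` is the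
    -- mate of `y`, the two are adjacent anyway.
    opposite-end : ∀ {x y} → x ≢ y → ¬ (x ~ y) → x ~ μ y
    opposite-end {x} {y} x≢y x≁y with x ≟ μ y
    ... | yes refl = contradiction (~-sym (mate-adj M y)) x≁y
    ... | no x≢μy with good x≢y x≢μy
    ...   | inj₁ (x~y , _) = contradiction x~y x≁y
    ...   | inj₂ (x~μy , _) = x~μy

    -- A non-neighbour `y` is reached in two steps through `μ y`.
    connected : Connected G
    connected x y with x ≟ y | x ~? y
    ... | yes refl | _ = here
    ... | no _ | yes x~y = step x~y here
    ... | no x≢y | no x≁y = step (opposite-end x≢y x≁y) (step (~-sym (mate-adj M y)) here)

    -- No augmenting path joins `p` to `q`. Excluding paths through one edge of `M` gives every edge
    -- an end that both `p` and `q` miss; excluding paths through two edges makes these ends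
    -- pairwise non-adjacent.
    two-exposed : ∀ {p q} S → p ∉ flat S → q ∉ flat S → ¬ Matchable (p ∷ q ∷ flat S) →
      ∃ λ S′ → flat S′ ↭ flat S × Indep (p ∷ q ∷ S′)
    two-exposed {p} {q} S p∉ q∉ ¬mt with orient S choose
      where
      blocked : ∀ {v} → v ∈ flat S → p ~ v → ¬ (q ~ μ v)
      blocked {v} v∈ p~v q~μv with flat-split {S = S} v∈
      ... | S₀ , τ = refute (p ∷ q ∷ []) (v ∷ []) ((p , v) ∷ (q , μ v) ∷ []) ¬mt τ
        ([] ∷ []) (here refl ∷ []) (p~v ∷ q~μv ∷ [])
        (rearrange (0F ∷ 2F ∷ 1F ∷ 3F ∷ []) refl)

      blocked′ : ∀ {v} → v ∈ flat S → ¬ (p ~ v) → ¬ (q ~ v)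
      blocked′ {v} v∈ p≁v q~v =
        blocked (flat-closed S v∈) (opposite-end (λ { refl → p∉ v∈ }) p≁v) (subst (q ~_) (≡-sym (μμ v)) q~v)

      choose : ∀ {v} → v ∈ S → ∃ λ w → (w ≡ v ⊎ w ≡ μ v) × (¬ (p ~ w) × ¬ (q ~ w) × w ∈ flat S)
      choose {v} v∈ with p ~? v | p ~? μ v
      ... | no p≁v | _ = v , inj₁ refl , p≁v , blocked′ (∈-flat⁺ v∈) p≁v , ∈-flat⁺ v∈
      ... | yes _ | no p≁μv = μ v , inj₂ refl , p≁μv , blocked′ (∈-flat⁺′ v∈) p≁μv , ∈-flat⁺′ v∈
      -- If `p` saw both ends, `q` could see neither, yet it always sees one of them.
      ... | yes p~v | yes p~μv = contradiction
        (opposite-end (λ { refl → q∉ (∈-flat⁺ v∈) })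
          (λ q~v → blocked (∈-flat⁺′ v∈) p~μv (subst (q ~_) (≡-sym (μμ v)) q~v)))
        (blocked (∈-flat⁺ v∈) p~v)
    ... | S′ , τ , avoid = S′ , τ , Indep-∷ p-isolated (Indep-∷ (proj₁ ∘ proj₂ ∘ avoid) ind)
      where
      p-isolated : ∀ {y} → y ∈ q ∷ S′ → ¬ (p ~ y)
      p-isolated (here refl) p~q = ¬mt (match ((p , q) ∷ []) (p~q ∷ []) S refl)
      p-isolated (there y∈) = proj₁ (avoid y∈)

      ind : Indep S′
      -- The augmenting path is `p`, `μ v`, `v`, `w`, `μ w`, `q`.
      ind {v} {w} v∈ w∈ v~w = refute (p ∷ q ∷ []) (v ∷ w ∷ []) ((p , μ v) ∷ (v , w) ∷ (q , μ w) ∷ []) ¬mt τ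
        ((~⇒≢ v~w ∷ []) ∷ [] ∷ []) (v∈ ∷ w∈ ∷ [])
        ( opposite-end (λ { refl → p∉ (proj₂ (proj₂ (avoid v∈))) }) (proj₁ (avoid v∈))
        ∷ v~w
        ∷ opposite-end (λ { refl → q∉ (proj₂ (proj₂ (avoid w∈))) }) (proj₁ (proj₂ (avoid w∈)))
        ∷ [])
        (rearrange (0F ∷ 3F ∷ 2F ∷ 4F ∷ 1F ∷ 5F ∷ []) refl)

    -- Four exposed vertices: a perfect matching of the rest or a barrier.

    record Deficient (X S : List V) : Set where
      constructor deficient
      field
        unmatchable : ¬ Matchable (X ++ flat S)
        free : ∀ {x} → x ∈ X → x ∉ flat S
        distinct : Unique (flat S)

    Deficient-resp-↭ : ∀ {X Y S} → X ↭ Y → Deficient X S → Deficient Y S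
    Deficient-resp-↭ {S = S} σ (deficient ¬mt free !S) = deficient
      (¬mt ∘ Matchable-resp-↭ (++⁺ʳ (flat S) (↭-sym σ))) (free ∘ ∈-resp-↭ (↭-sym σ)) !S

    -- For four distinct exposed vertices this certifies that no perfect matching exists: at most
    -- two of the |S| + 4 listed vertices can be matched to each other, and the remaining |S| + 2 or
    -- more have only |S| possible partners.
    Barrier : (X S : List V) → Set
    Barrier X S = ∃ λ S′ → flat S′ ↭ flat S × NoTwo (X ++ S′)

    Barrier-resp-↭ : ∀ {X Y S} → X ↭ Y → Barrier X S → Barrier Y S
    Barrier-resp-↭ σ (S′ , τ , noTwo) = S′ , τ , NoTwo-resp-↭ (++⁺ʳ S′ σ) noTwo

    -- Using the edge `p q` leaves `r` and `s` exposed, so they and the chosen ends form an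
    -- independent set. All edges then meet `p` or `q`. Disjoint edges `p x` and `q y` cannot both
    -- occur, since `r` and `s` could be matched to whichever mates of `x` and `y` become free, or
    -- to `p` or `q` directly.
    barrier-adjacent : ∀ {p q r s S} → p ~ q → Deficient (p ∷ q ∷ r ∷ s ∷ []) S → Barrier (p ∷ q ∷ r ∷ s ∷ []) S
    barrier-adjacent {p} {q} {r} {s} {S} p~q (deficient ¬mt free !S)
      with two-exposed {r} {s} S (free (there (there (here refl)))) (free (there (there (there (here refl)))))
        (¬mt ∘ Matchable-∷ p~q)
    ... | S′ , τ , ind = S′ , τ , NoTwo-doubleStar ind cross
      where
      S′⊆ : ∀ {v} → v ∈ S′ → v ∈ flat S
      S′⊆ = ∈-resp-↭ τ ∘ ∈-flat⁺

      r~μ : ∀ {v} → v ∈ S′ → r ~ μ v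
      r~μ v∈ = opposite-end (λ { refl → free (there (there (here refl))) (S′⊆ v∈) }) (ind (here refl) (there (there v∈)))

      s~μ : ∀ {v} → v ∈ S′ → s ~ μ v
      s~μ v∈ = opposite-end (λ { refl → free (there (there (there (here refl)))) (S′⊆ v∈) })
        (ind (there (here refl)) (there (there v∈)))

      refuting : ∀ Q P → Unique Q → All (_∈ S′) Q → All Edge P →
        pairs P ↭ p ∷ q ∷ r ∷ s ∷ flat Q → ⊥
      refuting Q P = refute (p ∷ q ∷ r ∷ s ∷ []) Q P ¬mt τ

      cross : ∀ {x y} → x ∈ r ∷ s ∷ S′ → y ∈ r ∷ s ∷ S′ → x ≢ y → p ~ x → q ~ y → ⊥
      cross (here refl) (here refl) x≢y _ _ = x≢y refl
      cross (there (here refl)) (there (here refl)) x≢y _ _ = x≢y refl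
      cross (here refl) (there (here refl)) _ p~r q~s =
        refuting [] ((p , r) ∷ (q , s) ∷ []) [] [] (p~r ∷ q~s ∷ [])
          (rearrange (0F ∷ 2F ∷ 1F ∷ 3F ∷ []) refl)
      cross (there (here refl)) (here refl) _ p~s q~r =
        refuting [] ((p , s) ∷ (q , r) ∷ []) [] [] (p~s ∷ q~r ∷ [])
          (rearrange (0F ∷ 3F ∷ 1F ∷ 2F ∷ []) refl)
      cross {y = v} (here refl) (there (there v∈)) _ p~r q~v =
        refuting (v ∷ []) ((p , r) ∷ (q , v) ∷ (s , μ v) ∷ []) ([] ∷ []) (v∈ ∷ []) (p~r ∷ q~v ∷ s~μ v∈ ∷ [])
          (rearrange (0F ∷ 2F ∷ 1F ∷ 4F ∷ 3F ∷ 5F ∷ []) refl)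
      cross {y = v} (there (here refl)) (there (there v∈)) _ p~s q~v =
        refuting (v ∷ []) ((p , s) ∷ (q , v) ∷ (r , μ v) ∷ []) ([] ∷ []) (v∈ ∷ []) (p~s ∷ q~v ∷ r~μ v∈ ∷ [])
          (rearrange (0F ∷ 3F ∷ 1F ∷ 4F ∷ 2F ∷ 5F ∷ []) refl)
      cross {x = v} (there (there v∈)) (here refl) _ p~v q~r =
        refuting (v ∷ []) ((q , r) ∷ (p , v) ∷ (s , μ v) ∷ []) ([] ∷ []) (v∈ ∷ []) (q~r ∷ p~v ∷ s~μ v∈ ∷ [])
          (rearrange (1F ∷ 2F ∷ 0F ∷ 4F ∷ 3F ∷ 5F ∷ []) refl)
      cross {x = v} (there (there v∈)) (there (here refl)) _ p~v q~s =
        refuting (v ∷ []) ((q , s) ∷ (p , v) ∷ (r , μ v) ∷ []) ([] ∷ []) (v∈ ∷ []) (q~s ∷ p~v ∷ r~μ v∈ ∷ [])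
          (rearrange (1F ∷ 3F ∷ 0F ∷ 4F ∷ 2F ∷ 5F ∷ []) refl)
      cross {v} {w} (there (there v∈)) (there (there w∈)) v≢w p~v q~w =
        refuting (v ∷ w ∷ []) ((p , v) ∷ (r , μ v) ∷ (q , w) ∷ (s , μ w) ∷ []) ((v≢w ∷ []) ∷ [] ∷ []) (v∈ ∷ w∈ ∷ [])
          (p~v ∷ r~μ v∈ ∷ q~w ∷ s~μ w∈ ∷ [])
          (rearrange (0F ∷ 4F ∷ 2F ∷ 5F ∷ 1F ∷ 6F ∷ 3F ∷ 7F ∷ []) refl)

    -- The neighbour v of p makes p the only exposed vertex adjacent to l, so every edge meets p or l.
    barrier-pivot : ∀ {p q z w l v S} T → let X = p ∷ q ∷ z ∷ w ∷ [] in
      Deficient X S → Indep X → flat (l ∷ T) ↭ flat S → Indep (z ∷ w ∷ T) →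
      p ~ l → q ~ μ l → v ∈ T → p ~ v → Barrier X S
    barrier-pivot {p} {q} {z} {w} {l} {v} {S} T (deficient ¬mt free !S) indX τ ind p~l q~μl v∈ p~v =
      l ∷ T , τ , NoTwo-resp-↭ (prep p (↭-sym (shift l (q ∷ z ∷ w ∷ []) T))) (NoTwo-doubleStar indI cross)
      where
      l∷T⊆ : ∀ {x} → x ∈ l ∷ T → x ∈ flat S
      l∷T⊆ = ∈-resp-↭ τ ∘ ∈-flat⁺

      exposed : ∀ {x y} → x ∈ p ∷ q ∷ z ∷ w ∷ [] → y ∈ l ∷ T → ¬ (x ~ y) → x ~ μ y
      exposed x∈ y∈ = opposite-end λ { refl → free x∈ (l∷T⊆ y∈) }

      q∈ : q ∈ p ∷ q ∷ z ∷ w ∷ []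
      q∈ = there (here refl)

      z∈ : z ∈ p ∷ q ∷ z ∷ w ∷ []
      z∈ = there (there (here refl))

      w∈ : w ∈ p ∷ q ∷ z ∷ w ∷ []
      w∈ = there (there (there (here refl)))

      l≢ : ∀ {j} → j ∈ T → l ≢ j
      l≢ j∈ refl with flat-unique (l ∷ T) (Unique-resp-↭ (↭-sym τ) !S)
      ... | l∉ ∷ _ = All.lookup l∉ j∈ refl

      z~μ : ∀ {j} → j ∈ T → z ~ μ j
      z~μ j∈ = exposed z∈ (there j∈) (ind (here refl) (there (there j∈)))

      w~μ : ∀ {j} → j ∈ T → w ~ μ j
      w~μ j∈ = exposed w∈ (there j∈) (ind (there (here refl)) (there (there j∈)))

      refuting : ∀ Q P → Unique Q → All (_∈ l ∷ T) Q → All Edge P →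
        pairs P ↭ p ∷ q ∷ z ∷ w ∷ flat Q → ⊥
      refuting Q P = refute (p ∷ q ∷ z ∷ w ∷ []) Q P ¬mt τ

      -- Once `p` takes `v` and `z` takes `μ v`, the vertices `q`, `w`, `l`, `μ l` must not be
      -- matchable. The roles of `z` and `w` can be exchanged.
      w≁l : ¬ (w ~ l)
      w≁l w~l = refuting (l ∷ v ∷ []) ((p , v) ∷ (z , μ v) ∷ (q , μ l) ∷ (w , l) ∷ [])
        ((l≢ v∈ ∷ []) ∷ [] ∷ []) (here refl ∷ there v∈ ∷ []) (p~v ∷ z~μ v∈ ∷ q~μl ∷ w~l ∷ [])
        (rearrange (0F ∷ 6F ∷ 2F ∷ 7F ∷ 1F ∷ 5F ∷ 3F ∷ 4F ∷ []) refl)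

      z≁l : ¬ (z ~ l)
      z≁l z~l = refuting (l ∷ v ∷ []) ((p , v) ∷ (w , μ v) ∷ (q , μ l) ∷ (z , l) ∷ [])
        ((l≢ v∈ ∷ []) ∷ [] ∷ []) (here refl ∷ there v∈ ∷ []) (p~v ∷ w~μ v∈ ∷ q~μl ∷ z~l ∷ [])
        (rearrange (0F ∷ 6F ∷ 3F ∷ 7F ∷ 1F ∷ 5F ∷ 2F ∷ 4F ∷ []) refl)

      w~μl : w ~ μ l
      w~μl = exposed w∈ (here refl) w≁l

      z~μl : z ~ μ l
      z~μl = exposed z∈ (here refl) z≁l

      q≁l : ¬ (q ~ l)
      q≁l q~l = refuting (l ∷ v ∷ []) ((p , v) ∷ (z , μ v) ∷ (q , l) ∷ (w , μ l) ∷ [])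
        ((l≢ v∈ ∷ []) ∷ [] ∷ []) (here refl ∷ there v∈ ∷ []) (p~v ∷ z~μ v∈ ∷ q~l ∷ w~μl ∷ [])
        (rearrange (0F ∷ 6F ∷ 2F ∷ 7F ∷ 1F ∷ 4F ∷ 3F ∷ 5F ∷ []) refl)

      q≁ : ∀ {j} → j ∈ T → ¬ (q ~ j)
      q≁ {j} j∈ q~j with v ≟ j
      -- Here `q` takes `v` in place of `p`, and `p` falls back on `l`.
      ... | yes refl = refuting (l ∷ v ∷ []) ((q , v) ∷ (z , μ v) ∷ (p , l) ∷ (w , μ l) ∷ [])
        ((l≢ v∈ ∷ []) ∷ [] ∷ []) (here refl ∷ there v∈ ∷ []) (q~j ∷ z~μ v∈ ∷ p~l ∷ w~μl ∷ [])
        (rearrange (1F ∷ 6F ∷ 2F ∷ 7F ∷ 0F ∷ 4F ∷ 3F ∷ 5F ∷ []) refl)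
      ... | no v≢j = refuting (v ∷ j ∷ []) ((p , v) ∷ (z , μ v) ∷ (q , j) ∷ (w , μ j) ∷ [])
        ((v≢j ∷ []) ∷ [] ∷ []) (there v∈ ∷ there j∈ ∷ []) (p~v ∷ z~μ v∈ ∷ q~j ∷ w~μ j∈ ∷ [])
        (rearrange (0F ∷ 4F ∷ 2F ∷ 5F ∷ 1F ∷ 6F ∷ 3F ∷ 7F ∷ []) refl)

      indI : Indep (q ∷ z ∷ w ∷ T)
      indI = Indep-∷ (λ { (here refl) → indX q∈ z∈ ; (there (here refl)) → indX q∈ w∈ ; (there (there j∈)) → q≁ j∈ }) ind

      cross : ∀ {x y} → x ∈ q ∷ z ∷ w ∷ T → y ∈ q ∷ z ∷ w ∷ T → x ≢ y → p ~ x → l ~ y → ⊥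
      cross (here refl) _ _ p~x _ = indX (here refl) q∈ p~x
      cross (there (here refl)) _ _ p~x _ = indX (here refl) z∈ p~x
      cross (there (there (here refl))) _ _ p~x _ = indX (here refl) w∈ p~x
      cross _ (here refl) _ _ l~y = q≁l (~-sym l~y)
      cross _ (there (here refl)) _ _ l~y = z≁l (~-sym l~y)
      cross _ (there (there (here refl))) _ _ l~y = w≁l (~-sym l~y)
      -- The disjoint paths `p`, `j`, `μ j`, `q` and `z`, `μ l`, `l`, `k`, `μ k`, `w` would both
      -- augment.
      cross {j} {k} (there (there (there j∈))) (there (there (there k∈))) j≢k p~j l~k =
        refuting (l ∷ j ∷ k ∷ []) ((p , j) ∷ (q , μ j) ∷ (z , μ l) ∷ (l , k) ∷ (w , μ k) ∷ [])
          ((l≢ j∈ ∷ l≢ k∈ ∷ []) ∷ (j≢k ∷ []) ∷ [] ∷ []) (here refl ∷ there j∈ ∷ there k∈ ∷ [])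
          (p~j ∷ exposed q∈ (there j∈) (q≁ j∈) ∷ z~μl ∷ l~k ∷ w~μ k∈ ∷ [])
          (rearrange (0F ∷ 6F ∷ 1F ∷ 7F ∷ 2F ∷ 5F ∷ 4F ∷ 8F ∷ 3F ∷ 9F ∷ []) refl)

    -- Everything except `l` is independent, so all edges form a star at `l`.
    barrier-star : ∀ {p q z w l S} T → let X = p ∷ q ∷ z ∷ w ∷ [] in
      Indep X → flat (l ∷ T) ↭ flat S → Indep (z ∷ w ∷ T) →
      (∀ {v} → v ∈ T → ¬ (p ~ v)) → (∀ {v} → v ∈ T → ¬ (q ~ v)) → Barrier X S
    barrier-star {p} {q} {z} {w} {l} T indX τ ind p≁ q≁ =
      l ∷ T , τ , NoTwo-resp-↭ (↭-sym (shift l (p ∷ q ∷ z ∷ w ∷ []) T)) (NoTwo-star (Indep-∷ p-isolated (Indep-∷ q-isolated ind)))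
      where
      q-isolated : ∀ {y} → y ∈ z ∷ w ∷ T → ¬ (q ~ y)
      q-isolated (here refl) = indX (there (here refl)) (there (there (here refl)))
      q-isolated (there (here refl)) = indX (there (here refl)) (there (there (there (here refl))))
      q-isolated (there (there y∈)) = q≁ y∈

      p-isolated : ∀ {y} → y ∈ q ∷ z ∷ w ∷ T → ¬ (p ~ y)
      p-isolated (here refl) = indX (here refl) (there (here refl))
      p-isolated (there (here refl)) = indX (here refl) (there (there (here refl)))
      p-isolated (there (there (here refl))) = indX (here refl) (there (there (there (here refl))))
      p-isolated (there (there (there y∈))) = p≁ y∈

    -- The edge l μ(l) can absorb p and q, after which only z and w are exposed.
    barrier-spread : ∀ {p q z w l S} → let X = p ∷ q ∷ z ∷ w ∷ [] in
      Deficient X S → Indep X → l ∈ flat S → p ~ l → q ~ μ l → Barrier X S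
    barrier-spread {p} {q} {z} {w} {l} {S} D@(deficient ¬mt free !S) indX l∈ p~l q~μl
      with S₀ , σ ← flat-split {S = S} l∈ =
      let T , ρ , ind = two-exposed {z} {w} S₀ (free (there (there (here refl))) ∘ S₀⊆)
            (free (there (there (there (here refl)))) ∘ S₀⊆) ¬mt₀
      in finish T (trans (prep _ (prep _ ρ)) σ) ind (search (p ~?_) T) (search (q ~?_) T)
      where
      S₀⊆ : ∀ {x} → x ∈ flat S₀ → x ∈ flat S
      S₀⊆ x∈ = ∈-resp-↭ σ (there (there x∈))

      ¬mt₀ : ¬ Matchable (z ∷ w ∷ flat S₀)
      ¬mt₀ mt = ¬mt (Matchable-resp-↭
        (trans (++⁺ʳ (flat S₀) (rearrange {ys = p ∷ q ∷ z ∷ w ∷ l ∷ μ l ∷ []} (0F ∷ 4F ∷ 1F ∷ 5F ∷ 2F ∷ 3F ∷ []) refl))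
               (++⁺ˡ (p ∷ q ∷ z ∷ w ∷ []) σ))
        (Matchable-∷ p~l (Matchable-∷ q~μl mt)))

      swap₁₂ : ∀ {x y : V} {L} → x ∷ y ∷ L ↭ y ∷ x ∷ L
      swap₁₂ = swap _ _ refl

      finish : ∀ T → flat (l ∷ T) ↭ flat S → Indep (z ∷ w ∷ T) →
        (∃ λ v → v ∈ T × p ~ v) ⊎ (∀ {v} → v ∈ T → ¬ (p ~ v)) →
        (∃ λ v → v ∈ T × q ~ v) ⊎ (∀ {v} → v ∈ T → ¬ (q ~ v)) →
        Barrier (p ∷ q ∷ z ∷ w ∷ []) S
      finish T τ ind (inj₁ (v , v∈ , p~v)) _ = barrier-pivot T D indX τ ind p~l q~μl v∈ p~v
      -- Symmetric to the previous case after exchanging `p` with `q` and `l` with `μ l`.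
      finish T τ ind (inj₂ _) (inj₁ (v , v∈ , q~v)) =
        Barrier-resp-↭ swap₁₂ (barrier-pivot T (Deficient-resp-↭ swap₁₂ D) (Indep-⊆ (∈-resp-↭ swap₁₂) indX)
          (trans (flat-flip l T) τ) ind q~μl (subst (p ~_) (≡-sym (μμ l)) p~l) v∈ q~v)
      finish T τ ind (inj₂ p≁) (inj₂ q≁) = barrier-star T indX τ ind p≁ q≁

    -- No edge of M can absorb two exposed vertices, so all four see the same end of each edge.
    barrier-unspread : ∀ {p q r s S} → let X = p ∷ q ∷ r ∷ s ∷ [] in
      Deficient X S → Indep X → Unique X →
      (∀ {v x y} → v ∈ flat S → x ∈ X → y ∈ X → x ≢ y → x ~ v → ¬ (y ~ μ v)) → Barrier X S
    barrier-unspread {p} {q} {r} {s} {S} (deficient ¬mt free !S) indX ((p≢q ∷ _) ∷ _) unspread with orient S choose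
      where
      X : List V
      X = p ∷ q ∷ r ∷ s ∷ []

      Avoided : V → Set
      Avoided w = ∀ {x} → x ∈ X → ¬ (x ~ w) × x ~ μ w

      avoid : ∀ {v} → v ∈ flat S → ¬ (p ~ v) → Avoided v
      avoid {v} v∈ p≁v {x} x∈ = x≁v , opposite-end (λ { refl → free x∈ v∈ }) x≁v
        where
        p~μv : p ~ μ v
        p~μv = opposite-end (λ { refl → free (here refl) v∈ }) p≁v

        x≁v : ¬ (x ~ v)
        x≁v x~v with x ≟ p
        ... | yes refl = p≁v x~v
        -- Missing `v`, the vertex `p` sees `μ v`; if `x` saw `v`, this edge would absorb both.
        ... | no x≢p = unspread v∈ x∈ (here refl) x≢p x~v p~μv

      choose : ∀ {v} → v ∈ S → ∃ λ w → (w ≡ v ⊎ w ≡ μ v) × Avoided w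
      choose {v} v∈ with p ~? v | p ~? μ v | q ~? v
      ... | no p≁v | _ | _ = v , inj₁ refl , avoid (∈-flat⁺ v∈) p≁v
      ... | yes _ | no p≁μv | _ = μ v , inj₂ refl , avoid (∈-flat⁺′ v∈) p≁μv
      ... | yes _ | yes p~μv | yes q~v =
        ⊥-elim (unspread (∈-flat⁺ v∈) (there (here refl)) (here refl) (≢-sym p≢q) q~v p~μv)
      ... | yes p~v | yes _ | no q≁v =
        ⊥-elim (unspread (∈-flat⁺ v∈) (here refl) (there (here refl)) p≢q p~v
          (opposite-end (λ { refl → free (there (here refl)) (∈-flat⁺ v∈) }) q≁v))
    ... | S′ , τ , avoided = S′ , τ , noTwo
      where
      X : List V
      X = p ∷ q ∷ r ∷ s ∷ []

      inside : ∀ {x y} → x ∈ X ++ S′ → y ∈ X ++ S′ → x ~ y → x ∈ S′ × y ∈ S′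
      inside x∈ y∈ x~y with ∈-++⁻ X x∈ | ∈-++⁻ X y∈
      ... | inj₁ x∈X | inj₁ y∈X = contradiction x~y (indX x∈X y∈X)
      ... | inj₁ x∈X | inj₂ y∈S′ = contradiction x~y (proj₁ (avoided y∈S′ x∈X))
      ... | inj₂ x∈S′ | inj₁ y∈X = contradiction (~-sym x~y) (proj₁ (avoided x∈S′ y∈X))
      ... | inj₂ x∈S′ | inj₂ y∈S′ = x∈S′ , y∈S′

      noTwo : NoTwo (X ++ S′)
      noTwo {a} {b} {c} {d} a∈ b∈ c∈ d∈ a~b c~d a≢c a≢d b≢c b≢d with inside a∈ b∈ a~b | inside c∈ d∈ c~d
      -- Given disjoint edges `a b` and `c d`, the four exposed vertices take the mates of their
      -- ends.
      ... | a∈S′ , b∈S′ | c∈S′ , d∈S′ = refute X (a ∷ b ∷ c ∷ d ∷ [])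
        ((a , b) ∷ (p , μ a) ∷ (q , μ b) ∷ (c , d) ∷ (r , μ c) ∷ (s , μ d) ∷ []) ¬mt τ
        ((~⇒≢ a~b ∷ a≢c ∷ a≢d ∷ []) ∷ (b≢c ∷ b≢d ∷ []) ∷ (~⇒≢ c~d ∷ []) ∷ [] ∷ [])
        (a∈S′ ∷ b∈S′ ∷ c∈S′ ∷ d∈S′ ∷ [])
        ( a~b ∷ proj₂ (avoided a∈S′ (here refl)) ∷ proj₂ (avoided b∈S′ (there (here refl)))
        ∷ c~d ∷ proj₂ (avoided c∈S′ (there (there (here refl))))
        ∷ proj₂ (avoided d∈S′ (there (there (there (here refl))))) ∷ [])
        (rearrange (4F ∷ 6F ∷ 0F ∷ 5F ∷ 1F ∷ 7F ∷ 8F ∷ # 10 ∷ 2F ∷ 9F ∷ 3F ∷ # 11 ∷ []) refl)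

    pick-two : ∀ {p q r s x y : V} → x ∈ p ∷ q ∷ r ∷ s ∷ [] → y ∈ p ∷ q ∷ r ∷ s ∷ [] → x ≢ y →
      ∃₂ λ z w → p ∷ q ∷ r ∷ s ∷ [] ↭ x ∷ y ∷ z ∷ w ∷ []
    pick-two {x = x} {y} x∈ y∈ x≢y
      with extract ((x≢y ∷ []) ∷ [] ∷ []) (All.lookup (x∈ ∷ y∈ ∷ []))
    ... | [] , σ = case ↭-length σ of λ ()
    ... | _ ∷ [] , σ = case ↭-length σ of λ ()
    ... | z ∷ w ∷ [] , σ = z , w , σ
    ... | _ ∷ _ ∷ _ ∷ _ , σ = case ↭-length σ of λ ()

    -- Three cases: an edge inside `X`, an edge of `M` whose ends are seen by two different exposed
    -- vertices, or neither.
    four-exposed : ∀ {p q r s} S → let X = p ∷ q ∷ r ∷ s ∷ [] in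
      Unique X → Deficient X S → Barrier X S
    four-exposed {p} {q} {r} {s} S !X D
      with search (λ x → Any.any? (x ~?_) X) X
         | search (λ v → Any.any? (λ x → x ~? v ×-dec Any.any? (λ y → ¬? (x ≟ y) ×-dec y ~? μ v) X) X) (flat S)
      where
      X : List V
      X = p ∷ q ∷ r ∷ s ∷ []
    ... | inj₁ (x , x∈ , x~X) | _ with find x~X
    ...   | y , y∈ , x~y with pick-two x∈ y∈ (~⇒≢ x~y)
    ...     | z , w , σ = Barrier-resp-↭ (↭-sym σ) (barrier-adjacent x~y (Deficient-resp-↭ σ D))
    four-exposed S !X D | inj₂ ind | inj₁ (v , v∈ , spread) with find spread
    ...   | x , x∈ , x~v , spread′ with find spread′
    ...     | y , y∈ , x≢y , y~μv with pick-two x∈ y∈ x≢y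
    ...       | z , w , σ = Barrier-resp-↭ (↭-sym σ)
      (barrier-spread (Deficient-resp-↭ σ D)
        (Indep-⊆ (∈-resp-↭ (↭-sym σ)) λ x∈ y∈ x~y → ind x∈ (lose y∈ x~y)) v∈ x~v y~μv)
    four-exposed S !X D | inj₂ ind | inj₂ unspread =
      barrier-unspread D (λ x∈ y∈ x~y → ind x∈ (lose y∈ x~y)) !X
        λ v∈ x∈ y∈ x≢y x~v y~μv → unspread v∈ (lose x∈ (x~v , lose y∈ (x≢y , y~μv)))

-- One end of every edge of M, and counting arguments.

module Transversals {m : ℕ} (G : SimpleGraph m) (M : PerfectMatching G) (good : GoodMatching.Good G M) where

  open GoodMatching G M
  open Exchange good

  Transversal : List V → Set
  Transversal T = flat T ↭ allFin m

  transversal-unique : ∀ {T} → Transversal T → Unique (flat T)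
  transversal-unique σ = Unique-resp-↭ (↭-sym σ) (allFin⁺ m)

  transversal-covers : ∀ {T} → Transversal T → ∀ x → x ∈ T ⊎ μ x ∈ T
  transversal-covers {T} σ x = ∈-flat⁻ T (∈-resp-↭ (↭-sym σ) (∈-allFin x))

  transversal-mate∉ : ∀ {T x} → Transversal T → x ∈ T → μ x ∉ T
  transversal-mate∉ {T} σ = mate∉ T (transversal-unique σ)

  ∉⇒mate∈ : ∀ {T x} → Transversal T → x ∉ T → μ x ∈ T
  ∉⇒mate∈ σ x∉ with transversal-covers σ _
  ... | inj₁ x∈ = contradiction x∈ x∉
  ... | inj₂ μx∈ = μx∈

  mate∈⇒∉ : ∀ {T x} → Transversal T → μ x ∈ T → x ∉ T
  mate∈⇒∉ σ μx∈ x∈ = transversal-mate∉ σ x∈ μx∈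

  Transversal-flip : ∀ {c I} → Transversal (c ∷ I) → Transversal (μ c ∷ I)
  Transversal-flip {c} {I} σ = trans (flat-flip c I) σ

  Transversal-resp-↭ : ∀ {T T′} → T ↭ T′ → Transversal T → Transversal T′
  Transversal-resp-↭ τ σ = trans (flat-↭ (↭-sym τ)) σ

  length-flat : ∀ S → length (flat S) ≡ length S + length S
  length-flat [] = refl
  length-flat (v ∷ S) = cong suc (≡-trans (cong suc (length-flat S)) (≡-sym (+-suc (length S) (length S))))

  transversal-length : ∀ {T} → Transversal T → length T + length T ≡ m
  transversal-length {T} σ = ≡-trans (≡-sym (length-flat T)) (≡-trans (↭-length σ) (length-tabulate id))

  μ-injective : ∀ {x y} → μ x ≡ μ y → x ≡ y
  μ-injective {x} {y} eq = ≡-trans (≡-sym (μμ x)) (≡-trans (cong μ eq) (μμ y))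

  representatives : ∀ n L → length L ≤ n → Unique L → (∀ {x} → x ∈ L → μ x ∈ L) → ∃ λ S → flat S ↭ L
  representatives _ [] _ _ _ = [] , refl
  representatives (suc n) (x ∷ L) (s≤s len) (x∉ ∷ !L) closed
    with ∈⇒↭∷ (∈-tail (closed (here refl)) (mate-nofix M x))
  ... | L′ , σ with Unique-resp-↭ σ !L
  ...   | μx∉ ∷ !L′
    with representatives n L′ (≤-trans (n≤1+n _) (≤-trans (≤-reflexive (≡-sym (↭-length σ))) len)) !L′
      (λ {y} y∈ → ∈-tail
        (∈-resp-↭ σ (∈-tail (closed (there (∈-resp-↭ (↭-sym σ) (there y∈))))
          (λ μy≡x → All.lookup μx∉ y∈ (≡-trans (cong μ (≡-sym μy≡x)) (μμ y)))))
        (λ μy≡μx → All.lookup x∉ (∈-resp-↭ (↭-sym σ) (there y∈)) (≡-sym (μ-injective μy≡μx))))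
  ...     | S , τ = x ∷ S , prep _ (trans (prep _ τ) (↭-sym σ))

  complete : ∀ X → Unique (flat X) → ∃ λ S → Transversal (X ++ S)
  complete X !X with extract !X (λ {x} _ → ∈-allFin x)
  ... | L , σ with Unique-++⁻ (flat X) (Unique-resp-↭ σ (allFin⁺ m))
  ...   | !L , disjoint with representatives (length L) L ≤-refl !L closed
    where
    closed : ∀ {x} → x ∈ L → μ x ∈ L
    closed {x} x∈ with ∈-++⁻ (flat X) (∈-resp-↭ σ (∈-allFin (μ x)))
    ... | inj₂ μx∈ = μx∈
    ... | inj₁ μx∈ = contradiction x∈ (disjoint (subst (_∈ flat X) (μμ x) (flat-closed X μx∈)))
  ...     | S , τ = S , trans (↭-reflexive (flat-++ X S)) (trans (++⁺ˡ (flat X) τ) (↭-sym σ))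

  Apart : V → V → Set
  Apart x y = x ≢ y × x ≢ μ y

  apart : ∀ {x y} → x ≢ y → μ x ≢ y → Apart x y
  apart {x} {y} x≢y μx≢y = x≢y , λ x≡μy → μx≢y (≡-trans (cong μ x≡μy) (μμ y))

  apart-mateʳ : ∀ {x y} → Apart x y → Apart x (μ y)
  apart-mateʳ {x} {y} (x≢y , x≢μy) = x≢μy , λ x≡ → x≢y (≡-trans x≡ (μμ y))

  apart-mate : ∀ {x y} → Apart x y → Apart (μ x) (μ y)
  apart-mate {x} {y} (x≢y , x≢μy) = (λ eq → x≢y (μ-injective eq)) ,
    λ eq → x≢μy (≡-trans (≡-sym (μμ x)) (cong μ (≡-trans eq (μμ y))))

  flat-unique⁺ : ∀ {S} → AllPairs Apart S → Unique (flat S)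
  flat-unique⁺ [] = []
  flat-unique⁺ {v ∷ S} (v-apart ∷ S-apart) =
    (≢-sym (mate-nofix M v) ∷ All.tabulate (proj₁ ∘ v∉)) ∷ All.tabulate (proj₂ ∘ v∉) ∷ flat-unique⁺ S-apart
    where
    v∉ : ∀ {y} → y ∈ flat S → v ≢ y × μ v ≢ y
    v∉ {y} y∈ with ∈-flat⁻ S y∈
    ... | inj₁ y∈S = proj₁ (All.lookup v-apart y∈S) ,
      λ eq → proj₂ (All.lookup v-apart y∈S) (≡-trans (≡-sym (μμ v)) (cong μ eq))
    ... | inj₂ μy∈S = (λ eq → proj₂ (All.lookup v-apart μy∈S) (≡-trans eq (≡-sym (μμ y)))) ,
      λ eq → proj₁ (All.lookup v-apart μy∈S) (≡-trans (≡-sym (μμ v)) (cong μ eq))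

  -- `D`, `I` and the set of mates of `I` are pairwise disjoint. All the arguments that some perfect
  -- matching cannot exist count vertices in this way.
  matching-bound : (N : PerfectMatching G) {D I : List V} → Unique D → Unique I → (∀ {x} → x ∈ I → x ∉ D) →
    (∀ {x} → x ∈ I → mate N x ∉ D × mate N x ∉ I) → length D + (length I + length I) ≤ m
  matching-bound N {D} {I} !D !I I∩D mates = subst (_≤ m) len
    (Unique⇒length≤ (Unique-++⁺ !D (Unique-++⁺ !I (Unique-map⁺ ν-injective !I) disjoint₁) disjoint₂))
    where
    ν-injective : ∀ {x y} → mate N x ≡ mate N y → x ≡ y
    ν-injective {x} {y} eq = ≡-trans (≡-sym (mate-invol N x)) (≡-trans (cong (mate N) eq) (mate-invol N y))

    disjoint₁ : ∀ {x} → ¬ (x ∈ I × x ∈ map (mate N) I)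
    disjoint₁ (x∈ , x∈′) with ∈-map⁻ (mate N) x∈′
    ... | y , y∈ , refl = proj₂ (mates y∈) x∈

    disjoint₂ : ∀ {x} → ¬ (x ∈ D × x ∈ I ++ map (mate N) I)
    disjoint₂ (x∈ , x∈′) with ∈-++⁻ I x∈′
    ... | inj₁ x∈I = I∩D x∈I x∈
    ... | inj₂ x∈N with ∈-map⁻ (mate N) x∈N
    ...   | y , y∈ , refl = proj₁ (mates y∈) x∈

    len : length (D ++ I ++ map (mate N) I) ≡ length D + (length I + length I)
    len = ≡-trans (length-++ D) (cong (length D +_) (≡-trans (length-++ I) (cong (length I +_) (length-map (mate N) I))))

  OneExtendable : Set
  OneExtendable = ∀ {a b} → a ~ b → Σ (PerfectMatching G) λ N → mate N a ≡ b

  mate≡⇒ : (N : PerfectMatching G) → ∀ {x y} → mate N x ≡ y → mate N y ≡ x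
  mate≡⇒ N {x} eq = ≡-trans (cong (mate N) (≡-sym eq)) (mate-invol N x)

  -- A perfect matching through `a b` would have to match the n vertices of the independent set `T`
  -- into the n - 2 other vertices outside `T`.
  no-edge-outside : OneExtendable → ∀ {T} → Transversal T → Indep T → ∀ {a b} → a ∉ T → b ∉ T → ¬ (a ~ b)
  no-edge-outside ext {T} σ ind {a} {b} a∉ b∉ a~b with ext a~b
  ... | N , Na≡b = <⇒≱ (s≤s (≤-trans (≤-reflexive (≡-sym (transversal-length σ))) (n≤1+n _)))
    (matching-bound N {a ∷ b ∷ []} ((~⇒≢ a~b ∷ []) ∷ [] ∷ []) (flat-unique T (transversal-unique σ))
      (λ { x∈ (here refl) → a∉ x∈ ; x∈ (there (here refl)) → b∉ x∈ })
      (λ {x} x∈ → (λ { (here eq) → b∉ (subst (_∈ T) (≡-trans (≡-sym (mate≡⇒ N eq)) Na≡b) x∈)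
                     ; (there (here eq)) → a∉ (subst (_∈ T) (≡-trans (≡-sym (mate≡⇒ N eq)) (mate≡⇒ N Na≡b)) x∈) })
                , λ Nx∈ → ind x∈ Nx∈ (mate-adj N x)))

  TwoEdges : (V → Set) → Set
  TwoEdges = TwoIndependentEdges G

  TwoEdges-map : ∀ {P Q : V → Set} → (∀ {x} → P x → Q x) → TwoEdges P → TwoEdges Q
  TwoEdges-map f (a , b , c , d , Pa , Pb , Pc , Pd , rest) = a , b , c , d , f Pa , f Pb , f Pc , f Pd , rest

  -- Two disjoint edges cannot both contain the given vertex.
  edge-avoiding : ∀ {P : V → Set} c → TwoEdges P → ∃₂ λ x y → P x × P y × x ≢ c × y ≢ c × x ~ y
  edge-avoiding e (a , b , c , d , Pa , Pb , Pc , Pd , a~b , c~d , a≢b , a≢c , a≢d , b≢c , b≢d , c≢d)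
    with a ≟ e | b ≟ e
  ... | no a≢e | no b≢e = a , b , Pa , Pb , a≢e , b≢e , a~b
  ... | yes refl | _ = c , d , Pc , Pd , ≢-sym a≢c , ≢-sym a≢d , c~d
  ... | no _ | yes refl = c , d , Pc , Pd , ≢-sym b≢c , ≢-sym b≢d , c~d

  -- Otherwise `c ∷ I` is an independent transversal, while one of the two disjoint edges avoids `c`
  -- and so lies entirely outside it.
  center-adjacent : OneExtendable → ∀ {c I} → Transversal (c ∷ I) → Indep I → TwoEdges (_∉ I) → ∃ λ i → i ∈ I × c ~ i
  center-adjacent ext {c} {I} σ ind two with search (c ~?_) I
  ... | inj₁ found = found
  ... | inj₂ none with edge-avoiding c two
  ...   | x , y , x∉ , y∉ , x≢c , y≢c , x~y = contradiction x~y
    (no-edge-outside ext σ (Indep-∷ none ind) (λ x∈ → x∉ (∈-tail x∈ x≢c)) (λ y∈ → y∉ (∈-tail y∈ y≢c)))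

  -- Labellings read off from stars and triangles.

  Labelled : ℕ → Set
  Labelled k = ∃₂ λ u v → Labelling G (suc k) M u v × (ConditionI G k u v ⊎ ConditionII G k u v)

  module Label {c : V} {I : List V} (σ : Transversal (c ∷ I)) where

    -- Reversing the list makes its head the last vertex v_n.
    v u : Fin (suc (length I)) → V
    v i = lookup (c ∷ I) (opposite i)
    u i = μ (v i)

    v-injective : ∀ {i j} → v i ≡ v j → i ≡ j
    v-injective {i} {j} eq = ≡-trans (≡-sym (opposite-involutive i)) (≡-trans
      (cong opposite (lookup-injective (flat-unique (c ∷ I) (transversal-unique σ)) (opposite i) (opposite j) eq)) (opposite-involutive j))

    v∈ : ∀ i → v i ∈ c ∷ I
    v∈ i = ∈-lookup (opposite i)

    label : ∀ {x} → x ∈ c ∷ I → ∃ λ i → v i ≡ x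
    label x∈ = opposite (Any.index x∈) ,
      ≡-trans (cong (lookup (c ∷ I)) (opposite-involutive (Any.index x∈))) (≡-sym (lookup-index x∈))

    labelling : Labelling G (suc (length I)) M u v
    labelling = (λ i → μμ (v i)) , injective
      where
      u≢v : ∀ i j → u i ≢ v j
      u≢v i j eq = transversal-mate∉ σ (v∈ i) (subst (_∈ c ∷ I) (≡-sym eq) (v∈ j))

      injective : Injective _≡_ _≡_ [ u , v ]
      injective {inj₁ i} {inj₁ j} eq = cong inj₁ (v-injective (μ-injective eq))
      injective {inj₁ i} {inj₂ j} eq = contradiction eq (u≢v i j)
      injective {inj₂ i} {inj₁ j} eq = contradiction (≡-sym eq) (u≢v j i)
      injective {inj₂ i} {inj₂ j} eq = cong inj₂ (v-injective eq)

    last : v (fromℕ (length I)) ≡ c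
    last = cong (lookup (c ∷ I)) (opposite-fromℕ (length I))

    v-init : ∀ i → v (inject₁ i) ≡ lookup I (opposite i)
    v-init i = cong (lookup (c ∷ I)) (opposite-inject₁ i)

    label-init : ∀ {x} → x ∈ I → ∃ λ i → v (inject₁ i) ≡ x
    label-init x∈ = opposite (Any.index x∈) , ≡-trans (v-init _)
      (≡-trans (cong (lookup I) (opposite-involutive (Any.index x∈))) (≡-sym (lookup-index x∈)))

    label-mate : ∀ {x} → μ x ∈ c ∷ I → ∃ λ i → u i ≡ x
    label-mate {x} μx∈ with label μx∈
    ... | i , eq = i , ≡-trans (cong μ eq) (μμ x)

  -- Gives condition (ii) with `c` as v_n. Replacing `c` by its mate gives another transversal with
  -- the same `I`, so the argument that finds a neighbour of v_n in `I` also finds one of u_n.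
  star-labelled : OneExtendable → ∀ {c I} → Transversal (c ∷ I) → Indep I → TwoEdges (_∉ I) → Labelled (length I)
  star-labelled ext {c} {I} σ ind two = u , v , labelling , inj₂ (independent , TwoEdges-map locate two , adjacent)
    where
    open Label σ

    independent : ∀ i j → adj G (v (inject₁ i)) (v (inject₁ j)) ≡ false
    independent i j with adj G (v (inject₁ i)) (v (inject₁ j)) in eq
    ... | false = refl
    ... | true = ⊥-elim (ind (∈-lookup (opposite i)) (∈-lookup (opposite j))
      (≡-trans (≡-sym (cong₂ (adj G) (v-init i) (v-init j))) eq))

    locate : ∀ {x} → x ∉ I → (∃ λ i → u i ≡ x) ⊎ v (fromℕ (length I)) ≡ x
    locate {x} x∉ with transversal-covers σ x
    ... | inj₁ (here refl) = inj₂ last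
    ... | inj₁ (there x∈) = contradiction x∈ x∉
    ... | inj₂ μx∈ = inj₁ (label-mate μx∈)

    adjacent : ∃ λ i → ∃ λ j → v (inject₁ i) ~ v (fromℕ (length I)) × v (inject₁ j) ~ u (fromℕ (length I))
    adjacent with center-adjacent ext σ ind two | center-adjacent ext (Transversal-flip σ) ind two
    ... | x , x∈ , c~x | y , y∈ , μc~y with label-init x∈ | label-init y∈
    ...   | i , refl | j , refl =
      i , j , subst (v (inject₁ i) ~_) (≡-sym last) (~-sym c~x)
            , subst (v (inject₁ j) ~_) (≡-sym (cong μ last)) (~-sym μc~y)

  -- An edge with an end outside the triangle is disjoint from some side of it, so the remaining
  -- vertices are isolated. The ends of the two outer edges have four distinct mates in `T`, whence
  -- n ≥ 4.
  triangle-labelled : ∀ {e f g I} → let T = e ∷ f ∷ g ∷ I in Transversal T → NoTwo T →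
    e ~ f → e ~ g → f ~ g → TwoEdges (_∉ T) → Labelled (length (f ∷ g ∷ I))
  triangle-labelled {e} {f} {g} {I} σ noTwo e~f e~g f~g
    two@(a , b , c , d , a∉ , b∉ , c∉ , d∉ , _ , _ , a≢b , a≢c , a≢d , b≢c , b≢d , c≢d) =
    u , v , labelling , inj₁ (four , triangle , TwoEdges-map (label-mate ∘ ∉⇒mate∈ σ) two)
    where
    open Label σ

    T : List V
    T = e ∷ f ∷ g ∷ I

    four : 4 ≤ length T
    four = Unique-⊆⇒length≤ {xs = map μ (a ∷ b ∷ c ∷ d ∷ [])} {ys = T}
      (Unique-map⁺ μ-injective ((a≢b ∷ a≢c ∷ a≢d ∷ []) ∷ (b≢c ∷ b≢d ∷ []) ∷ (c≢d ∷ []) ∷ [] ∷ []))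
      (All.lookup (∉⇒mate∈ σ a∉ ∷ ∉⇒mate∈ σ b∉ ∷ ∉⇒mate∈ σ c∉ ∷ ∉⇒mate∈ σ d∉ ∷ []))

    isolated : ∀ {x y} → x ∈ I → y ∈ T → ¬ (x ~ y)
    isolated {x} {y} x∈ y∈ x~y with flat-unique T (transversal-unique σ)
    ... | (_ ∷ _ ∷ e∉) ∷ (_ ∷ f∉) ∷ g∉ ∷ _ = go y∈
      where
      e∈ : e ∈ T
      e∈ = here refl

      f∈ : f ∈ T
      f∈ = there (here refl)

      g∈ : g ∈ T
      g∈ = there (there (here refl))

      x≢e : ∀ {y} → y ∈ I → y ≢ e
      x≢e y∈ = ≢-sym (All.lookup e∉ y∈)

      x≢f : ∀ {y} → y ∈ I → y ≢ f
      x≢f y∈ = ≢-sym (All.lookup f∉ y∈)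

      x≢g : ∀ {y} → y ∈ I → y ≢ g
      x≢g y∈ = ≢-sym (All.lookup g∉ y∈)

      x∈T : x ∈ T
      x∈T = there (there (there x∈))

      go : y ∈ T → ⊥
      go (here refl) = noTwo x∈T e∈ f∈ g∈ x~y f~g (x≢f x∈) (x≢g x∈) (~⇒≢ e~f) (~⇒≢ e~g)
      go (there (here refl)) = noTwo x∈T f∈ e∈ g∈ x~y e~g (x≢e x∈) (x≢g x∈) (≢-sym (~⇒≢ e~f)) (~⇒≢ f~g)
      go (there (there (here refl))) =
        noTwo x∈T g∈ e∈ f∈ x~y e~f (x≢e x∈) (x≢f x∈) (≢-sym (~⇒≢ e~g)) (≢-sym (~⇒≢ f~g))
      go (there (there (there y∈I))) =
        noTwo x∈T y∈ e∈ f∈ x~y e~f (x≢e x∈) (x≢f x∈) (x≢e y∈I) (x≢f y∈I)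

    corner : ∀ {x y} → x ∈ T → y ∈ T → x ~ y → x ≡ e ⊎ x ≡ f ⊎ x ≡ g
    corner (here eq) _ _ = inj₁ eq
    corner (there (here eq)) _ _ = inj₂ (inj₁ eq)
    corner (there (there (here eq))) _ _ = inj₂ (inj₂ eq)
    corner (there (there (there x∈))) y∈ x~y = contradiction x~y (isolated x∈ y∈)

    triangle : ∃ λ a → ∃ λ b → ∃ λ c → a ≢ b × a ≢ c × b ≢ c × v a ~ v b × v a ~ v c × v b ~ v c ×
      (∀ i j → v i ~ v j → (i ≡ a ⊎ i ≡ b ⊎ i ≡ c) × (j ≡ a ⊎ j ≡ b ⊎ j ≡ c))
    triangle with label (here refl) | label (there (here refl)) | label (there (there (here refl)))
    ... | a , va≡e | b , vb≡f | c , vc≡g =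
      a , b , c , differ va≡e vb≡f (~⇒≢ e~f) , differ va≡e vc≡g (~⇒≢ e~g) , differ vb≡f vc≡g (~⇒≢ f~g)
        , join a b va≡e vb≡f e~f , join a c va≡e vc≡g e~g , join b c vb≡f vc≡g f~g
        , λ i j vi~vj → index (corner (v∈ i) (v∈ j) vi~vj) , index (corner (v∈ j) (v∈ i) (~-sym vi~vj))
      where
      differ : ∀ {i j x y} → v i ≡ x → v j ≡ y → x ≢ y → i ≢ j
      differ refl refl x≢y refl = x≢y refl

      join : ∀ i j {x y} → v i ≡ x → v j ≡ y → x ~ y → v i ~ v j
      join _ _ refl refl x~y = x~y

      index : ∀ {i} → v i ≡ e ⊎ v i ≡ f ⊎ v i ≡ g → i ≡ a ⊎ i ≡ b ⊎ i ≡ c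
      index (inj₁ eq) = inj₁ (v-injective (≡-trans eq (≡-sym va≡e)))
      index (inj₂ (inj₁ eq)) = inj₂ (inj₁ (v-injective (≡-trans eq (≡-sym vb≡f))))
      index (inj₂ (inj₂ eq)) = inj₂ (inj₂ (v-injective (≡-trans eq (≡-sym vc≡g))))

-- Extending one edge or two disjoint edges.

module Extension {m : ℕ} (G : SimpleGraph m) (M : PerfectMatching G) (good : GoodMatching.Good G M) where

  open GoodMatching G M
  open Exchange good
  open Transversals G M good

  -- An edgeless `T` contradicts 1-extendability. Otherwise fix an edge `e f`: the other vertices
  -- are independent. If `e` or `f` has no neighbour among them, the other one is the centre of a
  -- star; if both have neighbours, these coincide and complete a triangle, since distinct ones
  -- would give two disjoint edges.
  noTwo-labelled : OneExtendable → ∀ {k T} → length T ≡ suc k → Transversal T → NoTwo T → TwoEdges (_∉ T) → Labelled k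
  noTwo-labelled ext {k} {T} len σ noTwo two with search (λ x → Any.any? (x ~?_) T) T
  ... | inj₂ none with edge-avoiding (proj₁ two) two
  ...   | x , y , x∉ , y∉ , _ , _ , x~y =
    contradiction x~y (no-edge-outside ext σ (λ x∈ y∈ x~y → none x∈ (lose y∈ x~y)) x∉ y∉)
  noTwo-labelled ext {k} {T} len σ noTwo two | inj₁ (e , e∈ , e~T) with find e~T
  ... | f , f∈ , e~f with extract ((~⇒≢ e~f ∷ []) ∷ [] ∷ []) (All.lookup (e∈ ∷ f∈ ∷ []))
  ...   | T₀ , τ = around (search (e ~?_) T₀) (search (f ~?_) T₀)
    where
    noTwo₀ : NoTwo (e ∷ f ∷ T₀)
    noTwo₀ = NoTwo-resp-↭ τ noTwo

    e∈₀ : e ∈ e ∷ f ∷ T₀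
    e∈₀ = here refl

    f∈₀ : f ∈ e ∷ f ∷ T₀
    f∈₀ = there (here refl)

    distinct : Unique (e ∷ f ∷ T₀)
    distinct = Unique-resp-↭ τ (flat-unique T (transversal-unique σ))

    e≢ : ∀ {y} → y ∈ T₀ → e ≢ y
    e≢ y∈ with distinct
    ... | (_ ∷ e∉) ∷ _ = All.lookup e∉ y∈

    f≢ : ∀ {y} → y ∈ T₀ → f ≢ y
    f≢ y∈ with distinct
    ... | _ ∷ f∉ ∷ _ = All.lookup f∉ y∈

    ind : Indep T₀
    ind x∈ y∈ x~y = noTwo₀ e∈₀ f∈₀ (there (there x∈)) (there (there y∈)) e~f x~y (e≢ x∈) (e≢ y∈) (f≢ x∈) (f≢ y∈)

    labelled : ∀ {c I} → T ↭ c ∷ I → Labelled (length I) → Labelled k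
    labelled ρ = subst Labelled (suc-injective (≡-trans (≡-sym (↭-length ρ)) len))

    outside : ∀ {c I} → T ↭ c ∷ I → TwoEdges (_∉ I)
    outside ρ = TwoEdges-map (λ x∉ x∈ → x∉ (∈-resp-↭ (↭-sym ρ) (there x∈))) two

    τ′ : T ↭ f ∷ e ∷ T₀
    τ′ = trans τ (swap _ _ refl)

    around : (∃ λ g → g ∈ T₀ × e ~ g) ⊎ (∀ {g} → g ∈ T₀ → ¬ (e ~ g)) →
             (∃ λ g → g ∈ T₀ × f ~ g) ⊎ (∀ {g} → g ∈ T₀ → ¬ (f ~ g)) → Labelled k
    around (inj₂ e≁) _ = labelled τ′ (star-labelled ext (Transversal-resp-↭ τ′ σ) (Indep-∷ e≁ ind) (outside τ′))
    around (inj₁ _) (inj₂ f≁) = labelled τ (star-labelled ext (Transversal-resp-↭ τ σ) (Indep-∷ f≁ ind) (outside τ))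
    around (inj₁ (g , g∈ , e~g)) (inj₁ (h , h∈ , f~h)) with g ≟ h
    ... | no g≢h = ⊥-elim (noTwo₀ e∈₀ (there (there g∈)) f∈₀ (there (there h∈)) e~g f~h
      (~⇒≢ e~f) (e≢ h∈) (≢-sym (f≢ g∈)) g≢h)
    ... | yes refl with ∈⇒↭∷ g∈
    ...   | T₁ , ρ = labelled τρ (triangle-labelled (Transversal-resp-↭ τρ σ) (NoTwo-resp-↭ τρ noTwo) e~f e~g f~h
      (TwoEdges-map (λ x∉ x∈ → x∉ (∈-resp-↭ (↭-sym τρ) x∈)) two))
      where
      τρ : T ↭ e ∷ f ∷ g ∷ T₁
      τρ = trans τ (prep _ (prep _ ρ))

  -- Unless `a b` lies in `M`, deleting `a` and `b` exposes exactly their mates; an unmatchable rest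
  -- then yields ends that form an independent transversal with `μ a` and `μ b`.
  extend-one : ∀ {a b} → a ~ b → (Σ (PerfectMatching G) λ N → mate N a ≡ b) ⊎ (∃ λ T → Transversal T × Indep T)
  extend-one {a} {b} a~b with μ a ≟ b
  ... | yes μa≡b = inj₁ (M , μa≡b)
  ... | no μa≢b with complete (μ a ∷ μ b ∷ []) (flat-unique⁺ ((apart-mate (apart (~⇒≢ a~b) μa≢b) ∷ []) ∷ [] ∷ []))
  ...   | S , σ = decide (matchable? (μ a ∷ μ b ∷ flat S))
    where
    σ′ : a ∷ b ∷ μ a ∷ μ b ∷ flat S ↭ allFin m
    σ′ = trans (++⁺ʳ (flat S) (rearrange {ys = μ a ∷ a ∷ μ b ∷ b ∷ []} (1F ∷ 3F ∷ 0F ∷ 2F ∷ []) refl))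
      (trans (↭-reflexive (cong₂ (λ x y → μ a ∷ x ∷ μ b ∷ y ∷ flat S) (≡-sym (μμ a)) (≡-sym (μμ b)))) σ)

    disjoint : ∀ {x} → x ∈ μ a ∷ μ b ∷ [] → x ∉ flat S
    disjoint x∈ with Unique-++⁻ (a ∷ b ∷ μ a ∷ μ b ∷ []) (Unique-resp-↭ (↭-sym σ′) (allFin⁺ m))
    ... | _ , apart-S = apart-S (there (there x∈))

    decide : Dec (Matchable (μ a ∷ μ b ∷ flat S)) →
      (Σ (PerfectMatching G) λ N → mate N a ≡ b) ⊎ (∃ λ T → Transversal T × Indep T)
    decide (yes (P , edges , τ)) with toPerfectMatching ((a , b) ∷ P) (a~b ∷ edges) (trans (prep _ (prep _ τ)) σ′)
    ... | N , N-edges = inj₁ (N , N-edges (here refl))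
    decide (no ¬mt) with two-exposed S (disjoint (here refl)) (disjoint (there (here refl))) ¬mt
    ... | S′ , τ , ind = inj₂ (μ a ∷ μ b ∷ S′ , trans (prep _ (prep _ (prep _ (prep _ τ)))) σ , ind)

  Extends : V → V → V → V → Set
  Extends a b c d = Σ (PerfectMatching G) λ N → mate N a ≡ b × mate N c ≡ d

  extends : ∀ {a b c d L} → a ~ b → c ~ d → Matchable L → a ∷ b ∷ c ∷ d ∷ L ↭ allFin m → Extends a b c d
  extends {a} {b} {c} {d} a~b c~d (P , edges , τ) σ
    with toPerfectMatching ((a , b) ∷ (c , d) ∷ P) (a~b ∷ c~d ∷ edges) (trans (prep _ (prep _ (prep _ (prep _ τ)))) σ)
  ... | N , N-edges = N , N-edges (here refl) , N-edges (there (here refl))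

  module _ (ext : OneExtendable) {k : ℕ} (2k : m ≡ suc k + suc k) where

    transversal-size : ∀ {T} → Transversal T → length T ≡ suc k
    transversal-size {T} σ = halve (length T) (suc k) (≡-trans (transversal-length σ) 2k)
      where
      halve : ∀ i j → i + i ≡ j + j → i ≡ j
      halve zero zero _ = refl
      halve (suc i) (suc j) eq = cong suc (halve i j (suc-injective
        (≡-trans (≡-sym (+-suc i i)) (≡-trans (suc-injective eq) (+-suc j j)))))

    -- The two edges meet only three edges of `M`: one loses both its ends `t` and `μ t`, so just
    -- `p` and `q` are exposed. If the rest is unmatchable, `p`, `q` and the chosen ends are the
    -- leaves of a star, and `t` serves as its centre.
    extend-onto-three : ∀ {a b c d t p q} → a ~ b → c ~ d → a ≢ b → a ≢ c → a ≢ d → b ≢ c → b ≢ d → c ≢ d →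
      AllPairs Apart (t ∷ p ∷ q ∷ []) → a ∷ b ∷ c ∷ d ∷ [] ↭ t ∷ μ t ∷ μ p ∷ μ q ∷ [] →
      Extends a b c d ⊎ Labelled k
    extend-onto-three {a} {b} {c} {d} {t} {p} {q} a~b c~d a≢b a≢c a≢d b≢c b≢d c≢d separate π
      with complete (t ∷ p ∷ q ∷ []) (flat-unique⁺ separate)
    ... | S , σ = decide (matchable? (p ∷ q ∷ flat S))
      where
      σ′ : a ∷ b ∷ c ∷ d ∷ p ∷ q ∷ flat S ↭ allFin m
      σ′ = trans (++⁺ʳ (p ∷ q ∷ flat S) π) (trans (++⁺ʳ (flat S)
        (rearrange {ys = t ∷ μ t ∷ p ∷ μ p ∷ q ∷ μ q ∷ []} (0F ∷ 1F ∷ 3F ∷ 5F ∷ 2F ∷ 4F ∷ []) refl)) σ)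

      disjoint : ∀ {x} → x ∈ p ∷ q ∷ [] → x ∉ flat S
      disjoint (here refl) with Unique-++⁻ (flat (t ∷ p ∷ q ∷ [])) (transversal-unique σ)
      ... | _ , apart-S = apart-S (there (there (here refl)))
      disjoint (there (here refl)) with Unique-++⁻ (flat (t ∷ p ∷ q ∷ [])) (transversal-unique σ)
      ... | _ , apart-S = apart-S (there (there (there (there (here refl)))))

      decide : Dec (Matchable (p ∷ q ∷ flat S)) → Extends a b c d ⊎ Labelled k
      decide (yes mt) = inj₁ (extends a~b c~d mt σ′)
      decide (no ¬mt) with two-exposed S (disjoint (here refl)) (disjoint (there (here refl))) ¬mt
      ... | S′ , τ , ind = inj₂ (subst Labelled (suc-injective (transversal-size ρ)) (star-labelled ext ρ ind
        ( a , b , c , d , avoids (here refl) , avoids (there (here refl)) , avoids (there (there (here refl)))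
        , avoids (there (there (there (here refl)))) , a~b , c~d , a≢b , a≢c , a≢d , b≢c , b≢d , c≢d)))
        where
        ρ : Transversal (t ∷ p ∷ q ∷ S′)
        ρ = trans (++⁺ˡ (t ∷ μ t ∷ p ∷ μ p ∷ q ∷ μ q ∷ []) τ) σ

        avoids′ : ∀ {x} → x ∈ t ∷ μ t ∷ μ p ∷ μ q ∷ [] → x ∉ p ∷ q ∷ S′
        avoids′ (here refl) x∈ with flat-unique _ (transversal-unique ρ)
        ... | t∉ ∷ _ = All.lookup t∉ x∈ refl
        avoids′ (there (here refl)) x∈ = transversal-mate∉ ρ (here refl) (there x∈)
        avoids′ (there (there (here refl))) x∈ = transversal-mate∉ ρ (there (here refl)) (there x∈)
        avoids′ (there (there (there (here refl)))) x∈ = transversal-mate∉ ρ (there (there (here refl))) (there x∈)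

        avoids : ∀ {x} → x ∈ a ∷ b ∷ c ∷ d ∷ [] → x ∉ p ∷ q ∷ S′
        avoids x∈ = avoids′ (∈-resp-↭ π x∈)

    -- The generic position, where four mates are exposed. A barrier completes them to a transversal
    -- that misses all of `a`, `b`, `c`, `d`.
    extend-onto-four : ∀ {a b c d} → a ~ b → c ~ d → a ≢ b → a ≢ c → a ≢ d → b ≢ c → b ≢ d → c ≢ d →
      AllPairs Apart (a ∷ b ∷ c ∷ d ∷ []) → Extends a b c d ⊎ Labelled k
    extend-onto-four {a} {b} {c} {d} a~b c~d a≢b a≢c a≢d b≢c b≢d c≢d
      ((ab ∷ ac ∷ ad ∷ []) ∷ (bc ∷ bd ∷ []) ∷ (cd ∷ []) ∷ [] ∷ [])
      with complete (μ a ∷ μ b ∷ μ c ∷ μ d ∷ []) (flat-unique⁺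
        ((apart-mate ab ∷ apart-mate ac ∷ apart-mate ad ∷ []) ∷ (apart-mate bc ∷ apart-mate bd ∷ []) ∷ (apart-mate cd ∷ []) ∷ [] ∷ []))
    ... | S , σ = decide (matchable? (X ++ flat S))
      where
      X : List V
      X = μ a ∷ μ b ∷ μ c ∷ μ d ∷ []

      σ′ : a ∷ b ∷ c ∷ d ∷ X ++ flat S ↭ allFin m
      σ′ = trans (↭-reflexive (cong₂ (λ { (x , y) (z , w) → x ∷ y ∷ z ∷ w ∷ X ++ flat S })
          (cong₂ _,_ (≡-sym (μμ a)) (≡-sym (μμ b))) (cong₂ _,_ (≡-sym (μμ c)) (≡-sym (μμ d)))))
        (trans (++⁺ʳ (flat S) (rearrange {ys = flat X} (1F ∷ 3F ∷ 5F ∷ 7F ∷ 0F ∷ 2F ∷ 4F ∷ 6F ∷ []) refl)) σ)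

      D : ¬ Matchable (X ++ flat S) → Deficient X S
      D ¬mt with Unique-++⁻ (flat X) (transversal-unique σ)
      ... | !S , apart-S = deficient ¬mt (λ x∈ → apart-S (∈-flat⁺ x∈)) !S

      decide : Dec (Matchable (X ++ flat S)) → Extends a b c d ⊎ Labelled k
      decide (yes mt) = inj₁ (extends a~b c~d mt σ′)
      decide (no ¬mt) with four-exposed S
        (Unique-map⁺ μ-injective ((a≢b ∷ a≢c ∷ a≢d ∷ []) ∷ (b≢c ∷ b≢d ∷ []) ∷ (c≢d ∷ []) ∷ [] ∷ [])) (D ¬mt)
      ... | S′ , τ , noTwo = inj₂ (noTwo-labelled ext (transversal-size ρ) ρ noTwo
        ( a , b , c , d , mate∈⇒∉ ρ (here refl) , mate∈⇒∉ ρ (there (here refl)) , mate∈⇒∉ ρ (there (there (here refl)))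
        , mate∈⇒∉ ρ (there (there (there (here refl)))) , a~b , c~d , a≢b , a≢c , a≢d , b≢c , b≢d , c≢d))
        where
        ρ : Transversal (X ++ S′)
        ρ = trans (++⁺ˡ (flat X) τ) σ

    extend-one-in-M : ∀ {a b c d} → a ~ b → c ~ d → a ≢ b → a ≢ c → a ≢ d → b ≢ c → b ≢ d → c ≢ d →
      μ a ≡ b → Extends a b c d ⊎ Labelled k
    extend-one-in-M {a} {b} {c} {d} a~b c~d a≢b a≢c a≢d b≢c b≢d c≢d refl with μ c ≟ d
    ... | yes μc≡d = inj₁ (M , refl , μc≡d)
    ... | no μc≢d = extend-onto-three {t = a} {μ c} {μ d} a~b c~d a≢b a≢c a≢d b≢c b≢d c≢d
      ((apart-mateʳ (apart a≢c b≢c) ∷ apart-mateʳ (apart a≢d b≢d) ∷ []) ∷ (apart-mate (apart c≢d μc≢d) ∷ []) ∷ [] ∷ [])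
      (↭-reflexive (cong₂ (λ x y → a ∷ μ a ∷ x ∷ y ∷ []) (≡-sym (μμ c)) (≡-sym (μμ d))))

    extend-sharing : ∀ {a b c d} → a ~ b → c ~ d → a ≢ b → a ≢ c → a ≢ d → b ≢ c → b ≢ d → c ≢ d →
      μ a ≡ c → Extends a b c d ⊎ Labelled k
    extend-sharing {a} {b} {c} {d} a~b c~d a≢b a≢c a≢d b≢c b≢d c≢d refl with μ b ≟ d
    ... | no μb≢d = extend-onto-three {t = a} {μ b} {μ d} a~b c~d a≢b a≢c a≢d b≢c b≢d c≢d
      ((apart-mateʳ (apart a≢b (≢-sym b≢c)) ∷ apart-mateʳ (apart a≢d c≢d) ∷ []) ∷ (apart-mate (apart b≢d μb≢d) ∷ []) ∷ [] ∷ [])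
      (trans (prep a (swap _ _ refl)) (↭-reflexive (cong₂ (λ x y → a ∷ μ a ∷ x ∷ y ∷ []) (≡-sym (μμ b)) (≡-sym (μμ d)))))
    -- The edges `a b` and `c d` close an alternating 4-cycle with two edges of `M`, and exchanging
    -- along it extends them.
    ... | yes refl with complete (a ∷ b ∷ []) (flat-unique⁺ ((apart a≢b (≢-sym b≢c) ∷ []) ∷ [] ∷ []))
    ...   | S , σ = inj₁ (extends a~b c~d (match [] [] S refl) (trans (prep a (swap _ _ refl)) σ))

    Extends-swap : ∀ {a b c d} → Extends a b c d → Extends c d a b
    Extends-swap (N , Na≡b , Nc≡d) = N , Nc≡d , Na≡b

    Extends-flipˡ : ∀ {a b c d} → Extends a b c d → Extends b a c d
    Extends-flipˡ (N , Na≡b , Nc≡d) = N , mate≡⇒ N Na≡b , Nc≡d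

    Extends-flipʳ : ∀ {a b c d} → Extends a b c d → Extends a b d c
    Extends-flipʳ (N , Na≡b , Nc≡d) = N , Na≡b , mate≡⇒ N Nc≡d

    extend-two : ∀ {a b c d} → a ~ b → c ~ d → a ≢ b → a ≢ c → a ≢ d → b ≢ c → b ≢ d → c ≢ d →
      Extends a b c d ⊎ Labelled k
    extend-two {a} {b} {c} {d} a~b c~d a≢b a≢c a≢d b≢c b≢d c≢d
      with μ a ≟ b | μ c ≟ d | μ a ≟ c | μ a ≟ d | μ b ≟ c | μ b ≟ d
    ... | yes μa≡b | _ | _ | _ | _ | _ = extend-one-in-M a~b c~d a≢b a≢c a≢d b≢c b≢d c≢d μa≡b
    ... | no _ | yes μc≡d | _ | _ | _ | _ = map₁ Extends-swap
      (extend-one-in-M c~d a~b c≢d (≢-sym a≢c) (≢-sym b≢c) (≢-sym a≢d) (≢-sym b≢d) a≢b μc≡d)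
    ... | no _ | no _ | yes μa≡c | _ | _ | _ = extend-sharing a~b c~d a≢b a≢c a≢d b≢c b≢d c≢d μa≡c
    ... | no _ | no _ | no _ | yes μa≡d | _ | _ = map₁ Extends-flipʳ
      (extend-sharing a~b (~-sym c~d) a≢b a≢d a≢c b≢d b≢c (≢-sym c≢d) μa≡d)
    ... | no _ | no _ | no _ | no _ | yes μb≡c | _ = map₁ Extends-flipˡ
      (extend-sharing (~-sym a~b) c~d (≢-sym a≢b) b≢c b≢d a≢c a≢d c≢d μb≡c)
    ... | no _ | no _ | no _ | no _ | no _ | yes μb≡d = map₁ (Extends-flipˡ ∘ Extends-flipʳ)
      (extend-sharing (~-sym a~b) (~-sym c~d) (≢-sym a≢b) b≢d b≢c a≢d a≢c (≢-sym c≢d) μb≡d)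
    ... | no μa≢b | no μc≢d | no μa≢c | no μa≢d | no μb≢c | no μb≢d =
      extend-onto-four a~b c~d a≢b a≢c a≢d b≢c b≢d c≢d
        ((apart a≢b μa≢b ∷ apart a≢c μa≢c ∷ apart a≢d μa≢d ∷ []) ∷ (apart b≢c μb≢c ∷ apart b≢d μb≢d ∷ [])
          ∷ (apart c≢d μc≢d ∷ []) ∷ [] ∷ [])

-- Consequences of conditions (i) and (ii).

module Obstructions {m k : ℕ} (G : SimpleGraph m) (M : PerfectMatching G) (good : GoodMatching.Good G M)
  {u v : Fin (suc k) → Fin m} (labelling : Labelling G (suc k) M u v) where

  open GoodMatching G M
  open Exchange good
  open Transversals G M good

  μu≡v : ∀ i → μ (u i) ≡ v i
  μu≡v = proj₁ labelling

  μv≡u : ∀ i → μ (v i) ≡ u i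
  μv≡u i = mate≡⇒ M (μu≡v i)

  v-injective : ∀ {i j} → v i ≡ v j → i ≡ j
  v-injective {i} {j} eq with proj₂ labelling {inj₂ i} {inj₂ j} eq
  ... | refl = refl

  u≢v : ∀ {i j} → u i ≢ v j
  u≢v {i} {j} eq with proj₂ labelling {inj₁ i} {inj₂ j} eq
  ... | ()

  u∈⊎v∈ : ∀ {W} → Transversal W → ∀ i → u i ∈ W ⊎ v i ∈ W
  u∈⊎v∈ {W} σ i with transversal-covers σ (v i)
  ... | inj₁ v∈ = inj₂ v∈
  ... | inj₂ μv∈ = inj₁ (subst (_∈ W) (μv≡u i) μv∈)

  v~u : ∀ {i j} → v i ≢ v j → ¬ (v i ~ v j) → v i ~ u j
  v~u {i} {j} vi≢vj vi≁vj = subst (v i ~_) (μv≡u j) (opposite-end vi≢vj vi≁vj)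

  last-or-init : (i : Fin (suc k)) → i ≡ fromℕ k ⊎ ∃ λ j → i ≡ inject₁ j
  last-or-init i with view i
  ... | ‵fromℕ = inj₁ refl
  ... | ‵inject₁ j = inj₂ (j , refl)

  mate-within : ∀ D (N : PerfectMatching G) {a b c d} → mate N a ≡ b → mate N c ≡ d →
    ∀ {x} → mate N x ∈ a ∷ b ∷ c ∷ d ∷ D → x ∈ a ∷ b ∷ c ∷ d ∷ [] ⊎ mate N x ∈ D
  mate-within D N Na≡b Nc≡d (here eq) = inj₁ (there (here (≡-trans (≡-sym (mate≡⇒ N eq)) Na≡b)))
  mate-within D N Na≡b Nc≡d (there (here eq)) = inj₁ (here (≡-trans (≡-sym (mate≡⇒ N eq)) (mate≡⇒ N Na≡b)))
  mate-within D N Na≡b Nc≡d (there (there (here eq))) =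
    inj₁ (there (there (there (here (≡-trans (≡-sym (mate≡⇒ N eq)) Nc≡d)))))
  mate-within D N Na≡b Nc≡d (there (there (there (here eq)))) =
    inj₁ (there (there (here (≡-trans (≡-sym (mate≡⇒ N eq)) (mate≡⇒ N Nc≡d)))))
  mate-within D N _ _ (there (there (there (there Nx∈)))) = inj₂ Nx∈

  module Star (cond : ConditionII G k u v) where

    two : TwoEdges (λ x → (∃ λ i → u i ≡ x) ⊎ v (fromℕ k) ≡ x)
    two = proj₁ (proj₂ cond)

    independent : ∀ i j → ¬ (v (inject₁ i) ~ v (inject₁ j))
    independent i j i~j with ≡-trans (≡-sym (proj₁ cond i j)) i~j
    ... | ()

    -- Among indices below n, `v i` is adjacent to `u j` whenever i ≠ j, so `W` takes all these v's
    -- or all these u's. With the v's, either end of the last edge has a neighbour in `W`. With the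
    -- u's, one of the two disjoint edges avoids the end of the last edge missing from `W`, and so
    -- lies inside `W`.
    no-indep-transversal : ∀ {W} → Transversal W → ¬ Indep W
    no-indep-transversal {W} σ ind with any? (λ i → v (inject₁ i) ∈? W)
    ... | yes (i , vi∈) = absurd (proj₂ (proj₂ cond))
      where
      all-v : ∀ j → v (inject₁ j) ∈ W
      all-v j with v (inject₁ i) ≟ v (inject₁ j) | u∈⊎v∈ σ (inject₁ j)
      ... | yes eq | _ = subst (_∈ W) eq vi∈
      ... | no _ | inj₂ vj∈ = vj∈
      ... | no vi≢vj | inj₁ uj∈ = contradiction (v~u vi≢vj (independent i j)) (ind vi∈ uj∈)

      absurd : (∃ λ i → ∃ λ j → v (inject₁ i) ~ v (fromℕ k) × v (inject₁ j) ~ u (fromℕ k)) → ⊥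
      absurd (i , j , vi~vₙ , vj~uₙ) with u∈⊎v∈ σ (fromℕ k)
      ... | inj₁ uₙ∈ = ind (all-v j) uₙ∈ vj~uₙ
      ... | inj₂ vₙ∈ = ind (all-v i) vₙ∈ vi~vₙ
    ... | no none = absurd (u∈⊎v∈ σ (fromℕ k))
      where
      all-u : ∀ j → u (inject₁ j) ∈ W
      all-u j with u∈⊎v∈ σ (inject₁ j)
      ... | inj₁ uj∈ = uj∈
      ... | inj₂ vj∈ = contradiction (j , vj∈) none

      inside : ∀ {x} → (∃ λ i → u i ≡ x) ⊎ v (fromℕ k) ≡ x →
        x ∈ W ⊎ x ≡ u (fromℕ k) ⊎ x ≡ v (fromℕ k)
      inside (inj₂ refl) = inj₂ (inj₂ refl)
      inside (inj₁ (i , refl)) with last-or-init i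
      ... | inj₁ refl = inj₂ (inj₁ refl)
      ... | inj₂ (j , refl) = inj₁ (all-u j)

      avoiding : ∀ c → (∀ {x} → x ≢ c → x ≡ u (fromℕ k) ⊎ x ≡ v (fromℕ k) → x ∈ W) → ⊥
      avoiding c other with edge-avoiding c two
      ... | x , y , Px , Py , x≢c , y≢c , x~y =
        ind ([ id , other x≢c ] (inside Px)) ([ id , other y≢c ] (inside Py)) x~y

      absurd : u (fromℕ k) ∈ W ⊎ v (fromℕ k) ∈ W → ⊥
      absurd (inj₁ uₙ∈) = avoiding (v (fromℕ k)) λ
        { _ (inj₁ refl) → uₙ∈ ; x≢vₙ (inj₂ refl) → contradiction refl x≢vₙ }
      absurd (inj₂ vₙ∈) = avoiding (u (fromℕ k)) λ
        { x≢uₙ (inj₁ refl) → contradiction refl x≢uₙ ; _ (inj₂ refl) → vₙ∈ }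

    I : List V
    I = tabulate (v ∘ inject₁)

    outside : ∀ {x} → (∃ λ i → u i ≡ x) ⊎ v (fromℕ k) ≡ x → x ∉ I
    outside (inj₁ (i , refl)) x∈ with ∈-tabulate⁻ x∈
    ... | j , eq = u≢v eq
    outside (inj₂ refl) x∈ with ∈-tabulate⁻ x∈
    ... | j , eq = fromℕ≢inject₁ (v-injective eq)

    -- The k leaves are independent and avoid the two given edges, so a matching through these edges
    -- would require 4 + 2k ≤ 2n = 2k + 2.
    not-extended : m ≡ suc k + suc k → ∃₂ λ a b → ∃₂ λ c d → a ~ b × c ~ d ×
      a ≢ b × a ≢ c × a ≢ d × b ≢ c × b ≢ d × c ≢ d ×
      ((N : PerfectMatching G) → mate N a ≡ b → mate N c ≡ d → ⊥)
    not-extended 2k with two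
    ... | a , b , c , d , Pa , Pb , Pc , Pd , a~b , c~d , a≢b , a≢c , a≢d , b≢c , b≢d , c≢d =
      a , b , c , d , a~b , c~d , a≢b , a≢c , a≢d , b≢c , b≢d , c≢d , λ N Na≡b Nc≡d →
        <⇒≱ (≤-trans (≤-reflexive (cong (2 +_) (+-suc k k))) (n≤1+n _))
          (subst₂ (λ i n → 4 + (i + i) ≤ n) (length-tabulate (v ∘ inject₁)) 2k
            (matching-bound N
              ((a≢b ∷ a≢c ∷ a≢d ∷ []) ∷ (b≢c ∷ b≢d ∷ []) ∷ (c≢d ∷ []) ∷ [] ∷ [])
              (tabulate⁺ λ eq → inject₁-injective (v-injective eq))
              avoids
              λ x∈ → (λ Nx∈ → [ avoids x∈ , (λ ()) ] (mate-within [] N Na≡b Nc≡d Nx∈)) , mate-outside N x∈))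
      where
      avoids : ∀ {x} → x ∈ I → x ∉ a ∷ b ∷ c ∷ d ∷ []
      avoids x∈ (here refl) = outside Pa x∈
      avoids x∈ (there (here refl)) = outside Pb x∈
      avoids x∈ (there (there (here refl))) = outside Pc x∈
      avoids x∈ (there (there (there (here refl)))) = outside Pd x∈

      mate-outside : ∀ N {x} → x ∈ I → mate N x ∉ I
      mate-outside N {x} x∈ Nx∈ with ∈-tabulate⁻ x∈ | ∈-tabulate⁻ Nx∈
      ... | i , refl | j , eq = independent i j (subst (v (inject₁ i) ~_) eq (mate-adj N x))

  module Triangle (4≤n : 4 ≤ suc k) {e f g : Fin (suc k)} (e≢f : e ≢ f) (e≢g : e ≢ g) (f≢g : f ≢ g)
    (ve~vf : v e ~ v f) (in-triangle : ∀ i j → v i ~ v j → (i ≡ e ⊎ i ≡ f ⊎ i ≡ g) × (j ≡ e ⊎ j ≡ f ⊎ j ≡ g)) where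

    corners : List (Fin (suc k))
    corners = e ∷ f ∷ g ∷ []

    corners-unique : Unique corners
    corners-unique = (e≢f ∷ e≢g ∷ []) ∷ (f≢g ∷ []) ∷ [] ∷ []

    corner : ∀ {i j} → v i ~ v j → i ∈ corners
    corner {i} {j} i~j with proj₁ (in-triangle i j i~j)
    ... | inj₁ eq = here eq
    ... | inj₂ (inj₁ eq) = there (here eq)
    ... | inj₂ (inj₂ eq) = there (there (here eq))

    others : ∃ λ is → allFin (suc k) ↭ corners ++ is
    others = extract corners-unique (λ {i} _ → ∈-allFin i)

    is : List (Fin (suc k))
    is = proj₁ others

    all-unique : Unique (corners ++ is)
    all-unique = Unique-resp-↭ (proj₂ others) (allFin⁺ (suc k))

    is-unique : Unique is
    is-unique = proj₁ (Unique-++⁻ corners all-unique)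

    is-disjoint : ∀ {i} → i ∈ is → i ∉ corners
    is-disjoint i∈is i∈ = proj₂ (Unique-++⁻ corners all-unique) i∈ i∈is

    is-length : suc k ≡ 3 + length is
    is-length = ≡-trans (≡-sym (length-tabulate id)) (↭-length (proj₂ others))

    isolated : ∀ {i j} → i ∈ is → ¬ (v i ~ v j)
    isolated i∈ i~j = is-disjoint i∈ (corner i~j)

    some-isolated : ∃ λ i → i ∈ is
    some-isolated = nonempty is (subst (4 ≤_) is-length 4≤n)
      where
      nonempty : ∀ (is : List (Fin (suc k))) → 4 ≤ 3 + length is → ∃ λ i → i ∈ is
      nonempty [] (s≤s (s≤s (s≤s ())))
      nonempty (i ∷ _) _ = i , here refl

    -- Since n ≥ 4, some `v i₀` is isolated among the v's; hence it is adjacent to every other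
    -- `u j`, and every other `v j` to `u i₀`. So `W` consists of all v's, containing a side of the
    -- triangle, or all u's, containing an edge.
    no-indep-transversal : TwoEdges (λ x → ∃ λ i → u i ≡ x) → ∀ {W} → Transversal W → ¬ Indep W
    no-indep-transversal (_ , _ , _ , _ , (i , refl) , (j , refl) , _ , _ , x~y , _) {W} σ ind = absurd (u∈⊎v∈ σ i₀)
      where
      i₀ = proj₁ some-isolated

      i₀-isolated : ∀ j → ¬ (v i₀ ~ v j)
      i₀-isolated j = isolated (proj₂ some-isolated)

      all-v : v i₀ ∈ W → ∀ j → v j ∈ W
      all-v v∈ j with v i₀ ≟ v j | u∈⊎v∈ σ j
      ... | yes eq | _ = subst (_∈ W) eq v∈
      ... | no _ | inj₂ vj∈ = vj∈
      ... | no v≢ | inj₁ uj∈ = contradiction (v~u v≢ (i₀-isolated j)) (ind v∈ uj∈)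

      all-u : u i₀ ∈ W → ∀ j → u j ∈ W
      all-u u∈ j with v j ≟ v i₀ | u∈⊎v∈ σ j
      ... | yes eq | _ = subst (λ i → u i ∈ W) (≡-sym (v-injective eq)) u∈
      ... | no _ | inj₁ uj∈ = uj∈
      ... | no v≢ | inj₂ vj∈ = contradiction (v~u v≢ (i₀-isolated j ∘ ~-sym)) (ind vj∈ u∈)

      absurd : u i₀ ∈ W ⊎ v i₀ ∈ W → ⊥
      absurd (inj₂ v∈) = ind (all-v v∈ e) (all-v v∈ f) ve~vf
      absurd (inj₁ u∈) = ind (all-u u∈ i) (all-u u∈ j) x~y

    T I : List V
    T = map v corners
    I = map v is

    -- The corners are counted with the four ends, because an isolated vertex cannot be matched to a
    -- corner either. The n - 3 isolated vertices then require 7 + 2(n - 3) ≤ 2n, which fails by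
    -- one.
    not-extended : TwoEdges (λ x → ∃ λ i → u i ≡ x) → m ≡ suc k + suc k → ∃₂ λ a b → ∃₂ λ c d → a ~ b × c ~ d ×
      a ≢ b × a ≢ c × a ≢ d × b ≢ c × b ≢ d × c ≢ d ×
      ((N : PerfectMatching G) → mate N a ≡ b → mate N c ≡ d → ⊥)
    not-extended (a , b , c , d , Pa , Pb , Pc , Pd , a~b , c~d , a≢b , a≢c , a≢d , b≢c , b≢d , c≢d) 2k =
      a , b , c , d , a~b , c~d , a≢b , a≢c , a≢d , b≢c , b≢d , c≢d , λ N Na≡b Nc≡d →
        <⇒≱ (s≤s (≤-reflexive too-many))
          (subst₂ (λ i n → 7 + (i + i) ≤ n) (length-map v is) 2k
            (matching-bound N
              (Unique-++⁺ ((a≢b ∷ a≢c ∷ a≢d ∷ []) ∷ (b≢c ∷ b≢d ∷ []) ∷ (c≢d ∷ []) ∷ [] ∷ [])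
                (Unique-map⁺ v-injective corners-unique) (λ (x∈ , x∈T) → u-side x∈ (proj₁ (v-side x∈T)) (proj₂ (v-side x∈T))))
              (Unique-map⁺ v-injective is-unique)
              (λ x∈ x∈D → [ avoids x∈ , disjoint x∈ ] (∈-++⁻ (a ∷ b ∷ c ∷ d ∷ []) x∈D))
              λ x∈ → (λ Nx∈ → [ avoids x∈ , mate-outside N x∈ ] (mate-within T N Na≡b Nc≡d Nx∈)) , mate-outside N x∈))
      where
      too-many : suc k + suc k ≡ 6 + (length is + length is)
      too-many = ≡-trans (cong₂ _+_ is-length is-length) (cong (3 +_)
        (≡-trans (+-suc r (2 + r)) (cong suc (≡-trans (+-suc r (1 + r)) (cong suc (+-suc r r))))))
        where r = length is

      v-side : ∀ {x js} → x ∈ map v js → ∃ λ j → x ≡ v j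
      v-side x∈ with ∈-map⁻ v x∈
      ... | j , _ , eq = j , eq

      u-side : ∀ {x} → x ∈ a ∷ b ∷ c ∷ d ∷ [] → ∀ j → x ≢ v j
      u-side (here refl) j eq = u≢v (≡-trans (proj₂ Pa) eq)
      u-side (there (here refl)) j eq = u≢v (≡-trans (proj₂ Pb) eq)
      u-side (there (there (here refl))) j eq = u≢v (≡-trans (proj₂ Pc) eq)
      u-side (there (there (there (here refl)))) j eq = u≢v (≡-trans (proj₂ Pd) eq)

      avoids : ∀ {x} → x ∈ I → x ∉ a ∷ b ∷ c ∷ d ∷ []
      avoids x∈I x∈ with v-side x∈I
      ... | j , eq = u-side x∈ j eq

      disjoint : ∀ {x} → x ∈ I → x ∉ T
      disjoint x∈I x∈T with ∈-map⁻ v x∈I | ∈-map⁻ v x∈T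
      ... | i , i∈ , eq | j , j∈ , eq′ =
        is-disjoint i∈ (subst (_∈ corners) (v-injective (≡-trans (≡-sym eq′) eq)) j∈)

      mate-outside : ∀ N {x js} → x ∈ I → mate N x ∉ map v js
      mate-outside N {x} x∈ Nx∈ with ∈-map⁻ v x∈ | v-side Nx∈
      ... | i , i∈ , refl | j , eq = isolated i∈ (subst (v i ~_) eq (mate-adj N x))

  no-indep-transversal : ConditionI G k u v ⊎ ConditionII G k u v → ∀ {W} → Transversal W → ¬ Indep W
  no-indep-transversal (inj₁ (4≤n , (_ , _ , _ , e≢f , e≢g , f≢g , e~f , _ , _ , only) , two)) =
    Triangle.no-indep-transversal 4≤n e≢f e≢g f≢g e~f only two
  no-indep-transversal (inj₂ cond) = Star.no-indep-transversal cond

  not-extended : ConditionI G k u v ⊎ ConditionII G k u v → m ≡ suc k + suc k →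
    ∃₂ λ a b → ∃₂ λ c d → a ~ b × c ~ d × a ≢ b × a ≢ c × a ≢ d × b ≢ c × b ≢ d × c ≢ d ×
      ((N : PerfectMatching G) → mate N a ≡ b → mate N c ≡ d → ⊥)
  not-extended (inj₁ (4≤n , (_ , _ , _ , e≢f , e≢g , f≢g , e~f , _ , _ , only) , two)) =
    Triangle.not-extended 4≤n e≢f e≢g f≢g e~f only two
  not-extended (inj₂ cond) = Star.not-extended cond

-- Forcing sets as complements of a few vertices.

module _ {m : ℕ} where

  without : List (Fin m) → Subset m
  without [] = ⊤
  without (x ∷ xs) = without xs - x

  ∈-without⁺ : ∀ {z} xs → z ∉ xs → z ∈ˢ without xs
  ∈-without⁺ [] _ = ∈⊤
  ∈-without⁺ (x ∷ xs) z∉ = x∈p∧x≢y⇒x∈p-y (∈-without⁺ xs (z∉ ∘ there)) (z∉ ∘ here)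

  ∈-without⁻ : ∀ {z} xs → z ∈ˢ without xs → z ∉ xs
  -- If `x` survived its own removal, removing it again would lower the size, yet removal is
  -- idempotent.
  ∈-without⁻ {z} (x ∷ xs) z∈ (here refl) = <-irrefl (cong ∣_∣ (p─q─q≡p─q (without xs) ⁅ x ⁆)) (x∈p⇒∣p-x∣<∣p∣ z∈)
  ∈-without⁻ (x ∷ xs) z∈ (there z∈xs) = ∈-without⁻ xs (p─q⊆p (without xs) ⁅ x ⁆ z∈) z∈xs

  ∣without∣ : ∀ {xs} → Unique xs → ∣ without xs ∣ + length xs ≤ m
  ∣without∣ {[]} _ = ≤-reflexive (≡-trans (+-identityʳ _) (∣⊤∣≡n m))
  ∣without∣ {x ∷ xs} (x∉ ∷ !xs) = ≤-trans (≤-reflexive (+-suc _ (length xs)))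
    (≤-trans (+-monoˡ-≤ (length xs) (x∈p⇒∣p-x∣<∣p∣ (∈-without⁺ xs λ x∈ → All.lookup x∉ x∈ refl))) (∣without∣ !xs))

module _ {k : ℕ} (G : SimpleGraph (2 * suc k)) (M : PerfectMatching G) where

  open GoodMatching G M

  -- If two edges of M span no alternating 4-cycle, then the other k − 1 edges of M form a forcing set.
  forcing⇒good : (∀ T → IsForcingSet G M T → 2 * k ≤ ∣ T ∣) → Good
  forcing⇒good minimal {x} {y} x≢y x≢μy
    with (x ~? y ×-dec μ x ~? μ y) ⊎-dec (x ~? μ y ×-dec μ x ~? y)
  ... | yes cross = cross
  ... | no ¬cross = contradiction (minimal (without Q) forcing) (<⇒≱ small)
    where
    Q : List V
    Q = x ∷ μ x ∷ y ∷ μ y ∷ []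

    x≢μx : x ≢ μ x
    x≢μx eq = mate-nofix M x (≡-sym eq)

    y≢μy : y ≢ μ y
    y≢μy eq = mate-nofix M y (≡-sym eq)

    μx≢y : μ x ≢ y
    μx≢y eq = x≢μy (≡-trans (≡-sym (μμ x)) (cong μ eq))

    μx≢μy : μ x ≢ μ y
    μx≢μy eq = x≢y (≡-trans (≡-sym (μμ x)) (≡-trans (cong μ eq) (μμ y)))

    Q-unique : Unique Q
    Q-unique = (x≢μx ∷ x≢y ∷ x≢μy ∷ []) ∷ (μx≢y ∷ μx≢μy ∷ []) ∷ (y≢μy ∷ []) ∷ [] ∷ []

    Q-closed : ∀ {z} → z ∈ Q → μ z ∈ Q
    Q-closed (here refl) = there (here refl)
    Q-closed (there (here refl)) = here (μμ x)
    Q-closed (there (there (here refl))) = there (there (there (here refl)))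
    Q-closed (there (there (there (here refl)))) = there (there (here (μμ y)))

    small : ∣ without Q ∣ < 2 * k
    -- Dropping four of the 2k + 2 vertices leaves at most 2k - 2.
    small = +-cancelʳ-≤ 3 _ _ (≤-trans (≤-reflexive (≡-sym (+-suc _ 3))) (≤-trans (∣without∣ Q-unique)
      (≤-trans (≤-reflexive (≡-trans (*-suc 2 k) (+-comm 2 (2 * k)))) (+-monoʳ-≤ (2 * k) (n≤1+n 2)))))

    -- Agreeing with `M` off `Q`, the matching `N` permutes the four vertices of `Q`. Pairing `x`
    -- with `y` or `μ y` would produce an excluded alternating 4-cycle, which leaves only the
    -- pairing of `M`.
    agree : (N : PerfectMatching G) → (∀ z → z ∈ˢ without Q → mate N z ≡ μ z) → ∀ z → mate N z ≡ μ z
    agree N fixed z with z ∈? Q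
    ... | no z∉ = fixed z (∈-without⁺ Q z∉)
    ... | yes z∈ = on-Q (ν-closed (here refl)) z∈
      where
      ν : V → V
      ν = mate N

      νν : ∀ z → ν (ν z) ≡ z
      νν = mate-invol N

      ν-injective : ∀ {z w} → ν z ≡ ν w → z ≡ w
      ν-injective {z} {w} eq = ≡-trans (≡-sym (νν z)) (≡-trans (cong ν eq) (νν w))

      ν-closed : ∀ {z} → z ∈ Q → ν z ∈ Q
      ν-closed {z} z∈ with ν z ∈? Q
      ... | yes νz∈ = νz∈
      ... | no νz∉ = contradiction
        (subst (_∈ Q) (≡-trans (cong μ (≡-trans (≡-sym (νν z)) (fixed (ν z) (∈-without⁺ Q νz∉)))) (μμ (ν z))) (Q-closed z∈)) νz∉

      on-Q : ν x ∈ Q → z ∈ Q → ν z ≡ μ z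
      on-Q (here eq) _ = contradiction eq (mate-nofix N x)
      on-Q (there (here νx≡μx)) z∈ = parallel (ν-closed (there (there (here refl)))) z∈
        where
        νμx≡x : ν (μ x) ≡ x
        νμx≡x = ≡-trans (cong ν (≡-sym νx≡μx)) (νν x)

        parallel : ν y ∈ Q → z ∈ Q → ν z ≡ μ z
        parallel (here νy≡x) _ = contradiction (ν-injective (≡-trans νμx≡x (≡-sym νy≡x))) μx≢y
        parallel (there (here νy≡μx)) _ = contradiction (ν-injective (≡-trans νx≡μx (≡-sym νy≡μx))) x≢y
        parallel (there (there (here νy≡y))) _ = contradiction νy≡y (mate-nofix N y)
        parallel _ (here refl) = νx≡μx
        parallel _ (there (here refl)) = ≡-trans νμx≡x (≡-sym (μμ x))
        parallel (there (there (there (here νy≡μy)))) (there (there (here refl))) = νy≡μy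
        parallel (there (there (there (here νy≡μy)))) (there (there (there (here refl)))) =
          ≡-trans (≡-trans (cong ν (≡-sym νy≡μy)) (νν y)) (≡-sym (μμ y))
      on-Q (there (there (here νx≡y))) _ with ν-closed (there (here refl))
      ... | here νμx≡x = contradiction (≡-trans (≡-sym νx≡y) (≡-trans (cong ν (≡-sym νμx≡x)) (νν (μ x)))) (≢-sym μx≢y)
      ... | there (here νμx≡μx) = contradiction νμx≡μx (mate-nofix N (μ x))
      ... | there (there (here νμx≡y)) = contradiction (ν-injective (≡-trans νx≡y (≡-sym νμx≡y))) x≢μx
      ... | there (there (there (here νμx≡μy))) = contradiction
        (inj₁ (subst (x ~_) νx≡y (mate-adj N x) , subst (μ x ~_) νμx≡μy (mate-adj N (μ x)))) ¬cross
      on-Q (there (there (there (here νx≡μy)))) _ with ν-closed (there (here refl))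
      ... | here νμx≡x = contradiction (≡-trans (≡-sym (νν (μ x))) (≡-trans (cong ν νμx≡x) νx≡μy)) μx≢μy
      ... | there (here νμx≡μx) = contradiction νμx≡μx (mate-nofix N (μ x))
      ... | there (there (here νμx≡y)) = contradiction
        (inj₂ (subst (x ~_) νx≡μy (mate-adj N x) , subst (μ x ~_) νμx≡y (mate-adj N (μ x)))) ¬cross
      ... | there (there (there (here νμx≡μy))) = contradiction (ν-injective (≡-trans νx≡μy (≡-sym νμx≡μy))) x≢μx

    forcing : IsForcingSet G M (without Q)
    forcing = (λ z z∈ → ∈-without⁺ Q λ μz∈ → ∈-without⁻ Q z∈ (subst (_∈ Q) (μμ z) (Q-closed μz∈))) , agree

-- Extendability for explicit edges, and assembly of the equivalence.

module _ {m : ℕ} (G : SimpleGraph m) where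

  open Matchings G

  extendable-one⁻ : Extendable 1 G → ∀ {a b} → a ~ b → Σ (PerfectMatching G) λ N → mate N a ≡ b
  extendable-one⁻ (_ , _ , _ , ext) {a} {b} a~b with ext (λ _ → a) (λ _ → b) ((λ _ → a~b) , injective)
    where
    injective : Injective {A = Fin 1 ⊎ Fin 1} {B = V} _≡_ _≡_ [ (λ _ → a) , (λ _ → b) ]
    injective {inj₁ 0F} {inj₁ 0F} _ = refl
    injective {inj₁ 0F} {inj₂ 0F} eq = contradiction eq (~⇒≢ a~b)
    injective {inj₂ 0F} {inj₁ 0F} eq = contradiction (≡-sym eq) (~⇒≢ a~b)
    injective {inj₂ 0F} {inj₂ 0F} _ = refl
  ... | N , N-extends = N , N-extends 0F

  extendable-two⁻ : Extendable 2 G → ∀ {a b c d} → a ~ b → c ~ d →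
    a ≢ b → a ≢ c → a ≢ d → b ≢ c → b ≢ d → c ≢ d →
    Σ (PerfectMatching G) λ N → mate N a ≡ b × mate N c ≡ d
  extendable-two⁻ (_ , _ , _ , ext) {a} {b} {c} {d} a~b c~d a≢b a≢c a≢d b≢c b≢d c≢d
    with ext (lookup (a ∷ c ∷ [])) (lookup (b ∷ d ∷ [])) ((λ { 0F → a~b ; 1F → c~d }) , injective)
    where
    injective : Injective {A = Fin 2 ⊎ Fin 2} {B = V} _≡_ _≡_ [ lookup (a ∷ c ∷ []) , lookup (b ∷ d ∷ []) ]
    injective {inj₁ 0F} {inj₁ 0F} _ = refl
    injective {inj₁ 0F} {inj₁ 1F} eq = contradiction eq a≢c
    injective {inj₁ 1F} {inj₁ 0F} eq = contradiction (≡-sym eq) a≢c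
    injective {inj₁ 1F} {inj₁ 1F} _ = refl
    injective {inj₁ 0F} {inj₂ 0F} eq = contradiction eq a≢b
    injective {inj₁ 0F} {inj₂ 1F} eq = contradiction eq a≢d
    injective {inj₁ 1F} {inj₂ 0F} eq = contradiction (≡-sym eq) b≢c
    injective {inj₁ 1F} {inj₂ 1F} eq = contradiction eq c≢d
    injective {inj₂ 0F} {inj₁ 0F} eq = contradiction (≡-sym eq) a≢b
    injective {inj₂ 0F} {inj₁ 1F} eq = contradiction eq b≢c
    injective {inj₂ 1F} {inj₁ 0F} eq = contradiction (≡-sym eq) a≢d
    injective {inj₂ 1F} {inj₁ 1F} eq = contradiction (≡-sym eq) c≢d
    injective {inj₂ 0F} {inj₂ 0F} _ = refl
    injective {inj₂ 0F} {inj₂ 1F} eq = contradiction eq b≢d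
    injective {inj₂ 1F} {inj₂ 0F} eq = contradiction (≡-sym eq) b≢d
    injective {inj₂ 1F} {inj₂ 1F} _ = refl
  ... | N , N-extends = N , N-extends 0F , N-extends 1F

-- Finite choice, replacing the excluded middle on whether every pair of independent edges extends.
choose : ∀ {n} {A : Fin n → Set} {B : Set} → (∀ i → A i ⊎ B) → (∀ i → A i) ⊎ B
choose {zero} _ = inj₁ λ ()
choose {suc n} f with f zero | choose (f ∘ suc)
... | inj₂ b | _ = inj₂ b
... | inj₁ _ | inj₂ b = inj₂ b
... | inj₁ a₀ | inj₁ as = inj₁ λ { zero → a₀ ; (suc i) → as i }

theorem4p1 : (k : ℕ) → 3 ≤ suc k → (G : SimpleGraph (2 * suc k)) →
    HasPerfectMatching G → MaxForcingNumber G k →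
    ((Extendable 1 G × ¬ Extendable 2 G) ⇔
    Σ (PerfectMatching G) λ M →
    Σ (Fin (suc k) → Fin (2 * suc k)) λ u →
    Σ (Fin (suc k) → Fin (2 * suc k)) λ v →
    Labelling G (suc k) M u v × ForcingNumber G M k ×
    (ConditionI G k u v ⊎ ConditionII G k u v))
-- For the forward direction, a matching attaining F(G) = n - 1 carries the labelling; the converse
-- works with the labelled matching it is given.
theorem4p1 k 3≤n G _ ((M , forcing) , _) = mk⇔ labels extendability
  where
  open Matchings G

  m≡ : 2 * suc k ≡ suc k + suc k
  m≡ = cong (suc k +_) (+-identityʳ (suc k))

  labels : Extendable 1 G × ¬ Extendable 2 G → _
  labels (ext₁ , ¬ext₂) = conclude (choose λ a → choose λ b → choose λ c → choose λ d → extend a b c d)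
    where
    good : GoodMatching.Good G M
    good = forcing⇒good G M (proj₂ forcing)

    open Transversals G M good using (Labelled)
    open Extension G M good using (Extends; extend-two)

    Extending : V → V → V → V → Set
    Extending a b c d = a ~ b → c ~ d → Unique (a ∷ b ∷ c ∷ d ∷ []) → Extends a b c d

    extend : ∀ a b c d → Extending a b c d ⊎ Labelled k
    extend a b c d with a ~? b | c ~? d | allPairs? (λ x y → ¬? (x ≟ y)) (a ∷ b ∷ c ∷ d ∷ [])
    ... | no a≁b | _ | _ = inj₁ λ a~b → contradiction a~b a≁b
    ... | yes _ | no c≁d | _ = inj₁ λ _ c~d → contradiction c~d c≁d
    ... | yes _ | yes _ | no repeated = inj₁ λ _ _ distinct → contradiction distinct repeated
    ... | yes a~b | yes c~d | yes ((a≢b ∷ a≢c ∷ a≢d ∷ []) ∷ (b≢c ∷ b≢d ∷ []) ∷ (c≢d ∷ []) ∷ [] ∷ []) =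
      map₁ (λ N _ _ _ → N) (extend-two (extendable-one⁻ G ext₁) m≡ a~b c~d a≢b a≢c a≢d b≢c b≢d c≢d)

    conclude : (∀ a b c d → Extending a b c d) ⊎ Labelled k → _
    conclude (inj₂ (u , v , labelling , cond)) = M , u , v , labelling , forcing , cond
    -- The order condition 2l + 2 ≤ 2n for l = 2 is twice the inequality 3 ≤ n.
    conclude (inj₁ extends) = contradiction (proj₁ ext₁ , *-monoʳ-≤ 2 3≤n , M , extension) ¬ext₂
      where
      extension : (a b : Fin 2 → V) → IsMatchingOfSize G 2 a b → Σ (PerfectMatching G) λ N → ∀ i → mate N (a i) ≡ b i
      extension a b (edges , injective) with extends (a 0F) (b 0F) (a 1F) (b 1F) (edges 0F) (edges 1F)
        ( ((λ eq → case injective {inj₁ 0F} {inj₂ 0F} eq of λ ())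
          ∷ (λ eq → case injective {inj₁ 0F} {inj₁ 1F} eq of λ ())
          ∷ (λ eq → case injective {inj₁ 0F} {inj₂ 1F} eq of λ ()) ∷ [])
        ∷ ((λ eq → case injective {inj₂ 0F} {inj₁ 1F} eq of λ ())
          ∷ (λ eq → case injective {inj₂ 0F} {inj₂ 1F} eq of λ ()) ∷ [])
        ∷ ((λ eq → case injective {inj₁ 1F} {inj₂ 1F} eq of λ ()) ∷ [])
        ∷ [] ∷ [])
      ... | N , Na≡b , Nc≡d = N , λ { 0F → Na≡b ; 1F → Nc≡d }

  extendability : _ → Extendable 1 G × ¬ Extendable 2 G
  extendability (M , u , v , labelling , forcing , cond) =
    (connected , *-monoʳ-≤ 2 (≤-trans (n≤1+n 2) 3≤n) , M , extension) , ¬two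
    where
    good : GoodMatching.Good G M
    good = forcing⇒good G M (proj₂ forcing)

    open GoodMatching G M using (module Exchange)
    open Exchange good using (connected)
    open Extension G M good using (extend-one)
    open Obstructions G M good labelling using (no-indep-transversal; not-extended)

    extension : (a b : Fin 1 → V) → IsMatchingOfSize G 1 a b → Σ (PerfectMatching G) λ N → ∀ i → mate N (a i) ≡ b i
    extension a b (edges , _) with extend-one (edges 0F)
    ... | inj₁ (N , Na≡b) = N , λ { 0F → Na≡b }
    ... | inj₂ (W , σ , ind) = ⊥-elim (no-indep-transversal cond σ ind)

    ¬two : ¬ Extendable 2 G
    ¬two ext₂ with not-extended cond m≡
    ... | a , b , c , d , a~b , c~d , a≢b , a≢c , a≢d , b≢c , b≢d , c≢d , blocked
      with extendable-two⁻ G ext₂ a~b c~d a≢b a≢c a≢d b≢c b≢d c≢d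
    ...   | N , Na≡b , Nc≡d = blocked N Na≡b Nc≡d
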